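{- There is an absolute constant $\beta$ such that the following holds. Consider an instance of the weighted mobile facility location problem (defined in the context). Let $S$ be any set of $k$ final locations that is a local optimum for the single-swap local search (i.e., no set $S'=(S\setminus\{s\})\cup\{v\}$ with $s\in S$, $v\in V\setminus S$ has strictly smaller cost than $S$). Then the cost of $S$ is at most $\beta$ times the cost of an optimal solution.
   Context: Weighted mobile facility location: we are given a finite set $V$ of nodes with a metric $c$ on $V$, a set $\mathcal{D}\subseteq V$ of clients where client $j$ has integer demand $d_j\ge 0$, and a set $\mathcal{F}\subseteq V$ of $k$ initial facility locations; "facility $i$" denotes the facility initially at $i\in\mathcal{F}$, and each facility $i$ has a weight $w_i\ge 0$ (the unweighted problem is the case $w_i=1$ for all $i$). A solution moves each facility $i$ to a final location $s_i\in V$, incurring movement cost $w_i\,c(i,s_i)$, and each client $j$ is assigned to its nearest final location $\sigma(j)$, incurring assignment cost $d_jc(j,\sigma(j))$. The cost of a solution is the total movement cost plus the total assignment cost. For a set $S$ of $k$ locations, its cost is the minimum over perfect matchings of $\mathcal{F}$ to $S$ of the total weighted movement cost, plus $\sum_j d_jc(j,\sigma(j))$ with $\sigma(j)$ the location of $S$ nearest to $j$.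
   Formalization: The distances c and the facility weights w_i are taken to be rational numbers instead of real numbers. -}

module Defs where

open import Data.Nat using (ℕ; zero; suc)
open import Data.Integer using (+_)
open import Data.Fin using (Fin; zero; suc; _≟_)
open import Data.Rational using (ℚ; 0ℚ; _+_; _*_; _⊓_; _≤_; _<_; _/_)
open import Data.Fin.Permutation using (Permutation′; _⟨$⟩ʳ_)
open import Data.Product using (Σ; ∃; _×_)
open import Function using (_∘_)
open import Function.Definitions using (Injective)
open import Relation.Binary.PropositionalEquality using (_≡_; _≢_)
open import Relation.Nullary using (¬_; yes; no)

sumℚ : {m : ℕ} → (Fin m → ℚ) → ℚ
sumℚ {zero}  f = 0ℚ
sumℚ {suc m} f = f zero + sumℚ (λ i → f (suc i))

minℚ : {m : ℕ} → (Fin (suc m) → ℚ) → ℚ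
minℚ {zero}  f = f zero
minℚ {suc m} f = f zero ⊓ minℚ (λ i → f (suc i))

ℕtoℚ : ℕ → ℚ
ℕtoℚ d = + d / 1

record IsMetric {n : ℕ} (c : Fin n → Fin n → ℚ) : Set where
  field
    nonneg    : ∀ x y → 0ℚ ≤ c x y
    self-zero : ∀ x → c x x ≡ 0ℚ
    zero-eq   : ∀ x y → c x y ≡ 0ℚ → x ≡ y
    symmetric : ∀ x y → c x y ≡ c y x
    triangle  : ∀ x y z → c x z ≤ c x y + c y z

-- An instance of weighted mobile facility location.
-- Nodes V = Fin n; k = suc k' facilities; facility i ∈ Fin k sits initially at
-- init i (init injective, so F = image of init is a set of k locations).
-- Clients: demand j is the demand of node j (0 for nodes not in 𝒟).
record Instance : Set where
  field
    n             : ℕ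
    k'            : ℕ
    c             : Fin n → Fin n → ℚ
    metric        : IsMetric c
    demand        : Fin n → ℕ
    init          : Fin (suc k') → Fin n
    init-inj      : Injective _≡_ _≡_ init
    weight        : Fin (suc k') → ℚ
    weight-nonneg : ∀ i → 0ℚ ≤ weight i

module _ (I : Instance) where
  open Instance I

  k : ℕ
  k = suc k'

  Solution : Set
  Solution = Fin k → Fin n

  movementCost : Solution → ℚ
  movementCost s = sumℚ (λ i → weight i * c (init i) (s i))

  assignmentCost : Solution → ℚ
  assignmentCost s = sumℚ (λ j → ℕtoℚ (demand j) * minℚ (λ t → c j (s t)))

  solutionCost : Solution → ℚ
  solutionCost s = movementCost s + assignmentCost s

  IsOptimal : Solution → Set
  IsOptimal s = ∀ s′ → solutionCost s ≤ solutionCost s′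

  IsLocationSet : (Fin k → Fin n) → Set
  IsLocationSet S = Injective _≡_ _≡_ S

  -- x is the cost of the set S: minimum over perfect matchings
  -- (facility i ↦ location S (π i)) of the solution cost
  IsSetCost : (Fin k → Fin n) → ℚ → Set
  IsSetCost S x =
    (Σ (Permutation′ k) λ π → x ≡ solutionCost (λ i → S (π ⟨$⟩ʳ i)))
    × (∀ (π : Permutation′ k) → x ≤ solutionCost (λ i → S (π ⟨$⟩ʳ i)))

  swap : (Fin k → Fin n) → Fin k → Fin n → (Fin k → Fin n)
  swap S t v u with u ≟ t
  ... | yes _ = v
  ... | no  _ = S u

  IsSwapLocalOpt : (Fin k → Fin n) → Set
  IsSwapLocalOpt S =
    ∀ (t : Fin k) (v : Fin n) → (∀ u → S u ≢ v) →
    ∀ (x y : ℚ) → IsSetCost S x → IsSetCost (swap S t v) y → ¬ (y < x)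

{-# OPTIONS --safe #-}
module Submission where

open import Defs
open import Data.Product using (Σ)
open import Data.Fin using (Fin)
open import Data.Rational using (ℚ; _≤_; _*_)
open import Data.Rational using (0ℚ; _+_; -_; _-_; _⊓_; _⊔_; nonNegative)
open import Data.Rational.Properties as ℚP using (module ≤-Reasoning)
open import Data.Rational.Solver using (module +-*-Solver)
open import Data.Nat as ℕ using (ℕ; zero; suc; s≤s; z≤n)
import Data.Nat.Properties as ℕP
import Data.Nat.Induction as ℕI
open import Induction.WellFounded using (Acc; acc)
open import Data.Bool using (Bool; true; false; not; if_then_else_)
open import Data.Empty using (⊥-elim)
open import Data.Unit using (⊤; tt)
open import Data.Product using (∃; _×_; _,_; proj₁; proj₂)
open import Data.Sum using (_⊎_; inj₁; inj₂)
open import Data.Fin using (zero; suc; _≟_; toℕ; punchOut; finToFun; funToFin)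
open import Data.Fin.Properties
  using (all?; any?; pigeonhole; toℕ≤pred[n]; finToFun-funToFin; injective⇒≤; punchOut-injective)
open import Data.Fin.Permutation as Perm
  using (Permutation′; permutation; flip; _⟨$⟩ʳ_; _⟨$⟩ˡ_; inverseʳ; inverseˡ)
open import Data.Vec.Functional using (updateAt)
open import Data.Vec.Functional.Properties using (updateAt-updates; updateAt-minimal)
open import Function using (const)
open import Function.Definitions using (Injective)
open import Relation.Binary.PropositionalEquality
open import Relation.Nullary using (Dec; yes; no; ¬_; ¬?; _×-dec_; _→-dec_)
open import Relation.Nullary.Decidable using (decidable-stable)

open +-*-Solver

-- Fix an optimal matching of the facilities to S, so that facility i ends at s i, and let o be any
-- solution. Write η p for the index of the location of s nearest to o p. For a walk
-- a → η a → … → i, closing s a, moving every facility l on the walk before i to s (η l) and i to o i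
-- is a swap; each shift costs at most 2 w l c(init l, o l), the clients of o i are served optimally
-- again, and the clients of s a only suffer if their optimal location is captured by s a.
-- Let U a be the largest gain (at least 0) over all walks leaving a; it is bounded by the loss of
-- closing s a, and U (η p) ≤ U p + 2 w p c(init p, o p).
--   * If η has no preimage at v, closing s v is cheap. Summing the last inequality over all p counts
--     U v with the in-degree of v, so the U v with in-degree other than 1 sum to O(OPT).
--   * The same telescoping along the remaining links bounds the total slack, that is, the sum of
--     w p (c(init p, s p) + c(init p, o p) - c(o p, s (η p))).
--   * A remaining link p → η p is classified by the demand D captured by s (η p): light if D ≤ 8 w p,
--     otherwise medium or heavy according to whether D ≤ 2 w (η p) or not. Light links are paid for
--     by the slack. A heavy link is so short that the gain of p itself is O(OPT); this follows from
--     moving facility η p directly to o p. A medium link followed by a medium or heavy one bounds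
--     U (η p) by U (η p) / 2 + O(OPT). Runs of heavy links telescope.

-- Inequalities and finite sums of rationals.

module FiniteSums where

  private
    variable
      m n : ℕ
      A B : Set
      x y z u : ℚ

  -- X ≤ Y follows from L ≤ R once Y - X = R - L, which is left to the ring solver.
  ≤-by : {X Y L R : ℚ} → L ≤ R → X + R ≡ Y + L → X ≤ Y
  ≤-by {X} {Y} {L} {R} L≤R eq = begin
    X              ≡⟨ solve 2 (λ X R → X := X :+ R :- R) refl X R ⟩
    X + R - R      ≡⟨ cong (_- R) eq ⟩
    Y + L - R      ≤⟨ ℚP.+-monoˡ-≤ (- R) (ℚP.+-monoʳ-≤ Y L≤R) ⟩
    Y + R - R      ≡⟨ solve 2 (λ Y R → Y :+ R :- R := Y) refl Y R ⟩
    Y              ∎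
    where open ≤-Reasoning

  infixr 6 _⊕_
  _⊕_ : x ≤ y → z ≤ u → x + z ≤ y + u
  _⊕_ = ℚP.+-mono-≤

  *-monoʳ : 0ℚ ≤ z → x ≤ y → z * x ≤ z * y
  *-monoʳ {z} 0≤z = ℚP.*-monoˡ-≤-nonNeg z {{nonNegative 0≤z}}

  *-nonneg : 0ℚ ≤ x → 0ℚ ≤ y → 0ℚ ≤ x * y
  *-nonneg {x} 0≤x 0≤y = ℚP.≤-trans (ℚP.≤-reflexive (sym (ℚP.*-zeroʳ x))) (*-monoʳ 0≤x 0≤y)

  +-nonneg : 0ℚ ≤ x → 0ℚ ≤ y → 0ℚ ≤ x + y
  +-nonneg = ℚP.+-mono-≤

  ℕtoℚ-nonneg : ∀ d → 0ℚ ≤ ℕtoℚ d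
  ℕtoℚ-nonneg d = ℚP.nonNegative⁻¹ (ℕtoℚ d) {{ℚP.normalize-nonNeg d 1}}

  when : Dec A → ℚ → ℚ
  when (yes _) x = x
  when (no  _) x = 0ℚ

  when-yes : (d : Dec A) → A → when d x ≡ x
  when-yes (yes _) a = refl
  when-yes (no ¬a) a = ⊥-elim (¬a a)

  when-no : (d : Dec A) → ¬ A → when d x ≡ 0ℚ
  when-no (yes a) ¬a = ⊥-elim (¬a a)
  when-no (no _)  ¬a = refl

  when-⇔ : (d : Dec A) (e : Dec B) → (A → B) → (B → A) → when d x ≡ when e x
  when-⇔ (yes a) e f g = sym (when-yes e (f a))
  when-⇔ (no ¬a) e f g = sym (when-no e (λ b → ¬a (g b)))

  when-nonneg : (d : Dec A) → (A → 0ℚ ≤ x) → 0ℚ ≤ when d x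
  when-nonneg (yes a) p = p a
  when-nonneg (no _)  p = ℚP.≤-refl

  when-≤ : (d : Dec A) → 0ℚ ≤ y → (A → x ≤ y) → when d x ≤ y
  when-≤ (yes a) 0≤y p = p a
  when-≤ (no _)  0≤y p = 0≤y

  when-mono : (d : Dec A) → (A → x ≤ y) → when d x ≤ when d y
  when-mono (yes a) p = p a
  when-mono (no _)  p = ℚP.≤-refl

  when-+ : (d : Dec A) → when d (x + y) ≡ when d x + when d y
  when-+ (yes _) = refl
  when-+ (no _)  = refl

  sum-cong : {f g : Fin m → ℚ} → (∀ i → f i ≡ g i) → sumℚ f ≡ sumℚ g
  sum-cong {zero}  p = refl
  sum-cong {suc m} p = cong₂ _+_ (p zero) (sum-cong (λ i → p (suc i)))

  sum-mono : {f g : Fin m → ℚ} → (∀ i → f i ≤ g i) → sumℚ f ≤ sumℚ g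
  sum-mono {zero}  p = ℚP.≤-refl
  sum-mono {suc m} p = p zero ⊕ sum-mono (λ i → p (suc i))

  sum-+ : (f g : Fin m → ℚ) → sumℚ (λ i → f i + g i) ≡ sumℚ f + sumℚ g
  sum-+ {zero}  f g = refl
  sum-+ {suc m} f g = trans
    (cong ((f zero + g zero) +_) (sum-+ (λ i → f (suc i)) (λ i → g (suc i))))
    (solve 4 (λ a b c d → a :+ b :+ (c :+ d) := a :+ c :+ (b :+ d)) refl (f zero) (g zero) _ _)

  sum-*ˡ : (c : ℚ) (f : Fin m → ℚ) → sumℚ (λ i → c * f i) ≡ c * sumℚ f
  sum-*ˡ {zero}  c f = sym (ℚP.*-zeroʳ c)
  sum-*ˡ {suc m} c f = trans (cong (c * f zero +_) (sum-*ˡ c (λ i → f (suc i))))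
                             (sym (ℚP.*-distribˡ-+ c _ _))

  sum-*ʳ : (f : Fin m → ℚ) (c : ℚ) → sumℚ (λ i → f i * c) ≡ sumℚ f * c
  sum-*ʳ f c = trans (sum-cong (λ i → ℚP.*-comm (f i) c)) (trans (sum-*ˡ c f) (ℚP.*-comm c _))

  sum-zero : (f : Fin m → ℚ) → (∀ i → f i ≡ 0ℚ) → sumℚ f ≡ 0ℚ
  sum-zero {zero}  f p = refl
  sum-zero {suc m} f p = cong₂ _+_ (p zero) (sum-zero (λ i → f (suc i)) (λ i → p (suc i)))

  sum-nonneg : {f : Fin m → ℚ} → (∀ i → 0ℚ ≤ f i) → 0ℚ ≤ sumℚ f
  sum-nonneg {m} p = ℚP.≤-trans (ℚP.≤-reflexive (sym (sum-zero {m} (λ _ → 0ℚ) (λ _ → refl)))) (sum-mono p)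

  sum-comm : (f : Fin m → Fin n → ℚ) →
             sumℚ (λ i → sumℚ (λ j → f i j)) ≡ sumℚ (λ j → sumℚ (λ i → f i j))
  sum-comm {zero} {n} f = sym (sum-zero {n} (λ _ → 0ℚ) (λ _ → refl))
  sum-comm {suc m} f = trans (cong (sumℚ (f zero) +_) (sum-comm (λ i → f (suc i))))
                             (sym (sum-+ (f zero) (λ j → sumℚ (λ i → f (suc i) j))))

  sum-when : (f : Fin m → ℚ) (i : Fin m) → sumℚ (λ l → when (l ≟ i) (f l)) ≡ f i
  sum-when f zero = trans (cong (f zero +_) (sum-zero (λ l → when (suc l ≟ zero) (f (suc l))) (λ _ → refl)))
                          (ℚP.+-identityʳ _)
  sum-when f (suc i) = trans (ℚP.+-identityˡ _)
    (trans (sum-cong (λ l → when-⇔ (suc l ≟ suc i) (l ≟ i) (λ { refl → refl }) (cong suc)))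
           (sum-when (λ l → f (suc l)) i))

  sum-when-const : (i : Fin m) (x : ℚ) → sumℚ (λ l → when (i ≟ l) x) ≡ x
  sum-when-const i x = trans (sum-cong (λ l → when-⇔ (i ≟ l) (l ≟ i) sym sym)) (sum-when (λ _ → x) i)

  term≤sum : {f : Fin m → ℚ} → (∀ i → 0ℚ ≤ f i) → ∀ i → f i ≤ sumℚ f
  term≤sum {f = f} p i = ℚP.≤-trans (ℚP.≤-reflexive (sym (sum-when f i)))
    (sum-mono (λ l → when-≤ (l ≟ i) (p l) (λ _ → ℚP.≤-refl)))

  terms≤sum : {f : Fin m → ℚ} → (∀ i → 0ℚ ≤ f i) → ∀ {i j} → i ≢ j → f i + f j ≤ sumℚ f
  terms≤sum {f = f} p {i} {j} i≢j = begin
    f i + f j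
      ≡⟨ sym (cong₂ _+_ (sum-when f i) (sum-when f j)) ⟩
    sumℚ (λ l → when (l ≟ i) (f l)) + sumℚ (λ l → when (l ≟ j) (f l))
      ≡⟨ sym (sum-+ (λ l → when (l ≟ i) (f l)) (λ l → when (l ≟ j) (f l))) ⟩
    sumℚ (λ l → when (l ≟ i) (f l) + when (l ≟ j) (f l))
      ≤⟨ sum-mono pointwise ⟩
    sumℚ f ∎
    where
    open ≤-Reasoning
    pointwise : ∀ l → when (l ≟ i) (f l) + when (l ≟ j) (f l) ≤ f l
    pointwise l with l ≟ i | l ≟ j
    ... | yes refl | yes refl = ⊥-elim (i≢j refl)
    ... | yes _    | no _     = ℚP.≤-reflexive (ℚP.+-identityʳ _)
    ... | no _     | yes _    = ℚP.≤-reflexive (ℚP.+-identityˡ _)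
    ... | no _     | no _     = p l

  sum-fibres : (φ : Fin n → Fin m) (f : Fin n → ℚ) →
               sumℚ (λ i → sumℚ (λ j → when (φ j ≟ i) (f j))) ≡ sumℚ f
  sum-fibres φ f = trans (sum-comm (λ i j → when (φ j ≟ i) (f j)))
                         (sum-cong (λ j → sum-when-const (φ j) (f j)))

open FiniteSums

-- Minima, injections and permutations on finite types.

module FiniteMaps where

  private
    variable
      m n : ℕ

  minℚ-≤ : (f : Fin (suc m) → ℚ) → ∀ j → minℚ f ≤ f j
  minℚ-≤ {zero}  f zero    = ℚP.≤-refl
  minℚ-≤ {suc m} f zero    = ℚP.p⊓q≤p _ _
  minℚ-≤ {suc m} f (suc j) = ℚP.≤-trans (ℚP.p⊓q≤q (f zero) _) (minℚ-≤ (λ i → f (suc i)) j)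

  minℚ-attained : (f : Fin (suc m) → ℚ) → ∃ λ i → minℚ f ≡ f i
  minℚ-attained {zero}  f = zero , refl
  minℚ-attained {suc m} f with ℚP.⊓-sel (f zero) (minℚ (λ i → f (suc i)))
  ... | inj₁ p = zero , p
  ... | inj₂ p with minℚ-attained (λ i → f (suc i))
  ...   | i , q = suc i , trans p q

  minℚ-cong : {f g : Fin (suc m) → ℚ} → (∀ i → f i ≡ g i) → minℚ f ≡ minℚ g
  minℚ-cong {zero}  p = p zero
  minℚ-cong {suc m} p = cong₂ _⊓_ (p zero) (minℚ-cong (λ i → p (suc i)))

  argmin-on : {P : Fin m → Set} → (∀ i → Dec (P i)) → (f : Fin m → ℚ) → ∃ P →
              ∃ λ i → P i × (∀ j → P j → f i ≤ f j)
  argmin-on {zero}  P? f (() , _)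
  argmin-on {suc m} {P} P? f (i₀ , p₀) with any? (λ i → P? (suc i)) | P? zero
  ... | no ¬tail | no ¬p = ⊥-elim (none i₀ p₀)
    where
    none : ∀ i → ¬ P i
    none zero    p = ¬p p
    none (suc i) p = ¬tail (i , p)
  ... | no ¬tail | yes p = zero , p , least
    where
    least : ∀ j → P j → f zero ≤ f j
    least zero    _ = ℚP.≤-refl
    least (suc j) q = ⊥-elim (¬tail (j , q))
  ... | yes tail | d with argmin-on (λ i → P? (suc i)) (λ i → f (suc i)) tail
  ...   | i , p , least with d
  ...     | no ¬p = suc i , p , λ { zero q → ⊥-elim (¬p q) ; (suc j) q → least j q }
  ...     | yes q with ℚP.≤-total (f zero) (f (suc i))
  ...       | inj₁ le = zero , q , λ { zero _ → ℚP.≤-refl ; (suc j) r → ℚP.≤-trans le (least j r) }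
  ...       | inj₂ ge = suc i , p , λ { zero _ → ge ; (suc j) r → least j r }

  injective⇒surjective : {f : Fin m → Fin m} → Injective _≡_ _≡_ f → ∀ y → ∃ λ x → f x ≡ y
  injective⇒surjective {suc m} {f} inj y with any? (λ x → f x ≟ y)
  ... | yes p = p
  ... | no ¬p = ⊥-elim (ℕP.<-irrefl refl (injective⇒≤ {f = λ x → punchOut (y≢f x)}
                  (λ {a} {b} eq → inj (punchOut-injective (y≢f a) (y≢f b) eq))))
    where
    y≢f : ∀ x → y ≢ f x
    y≢f x eq = ¬p (x , sym eq)

  injective⇒permutation : {f : Fin m → Fin m} → Injective _≡_ _≡_ f →
                          Σ (Permutation′ m) λ ρ → ∀ i → ρ ⟨$⟩ʳ i ≡ f i
  injective⇒permutation {f = f} inj =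
    permutation f (λ y → proj₁ (surj y)) (λ y → proj₂ (surj y)) (λ x → inj (proj₂ (surj (f x)))) , λ _ → refl
    where surj = injective⇒surjective inj

  permutation-injective : (ρ : Permutation′ m) → Injective _≡_ _≡_ (ρ ⟨$⟩ʳ_)
  permutation-injective ρ {x} {y} eq =
    trans (sym (inverseˡ ρ)) (trans (cong (ρ ⟨$⟩ˡ_) eq) (inverseˡ ρ))

  injective? : (f : Fin m → Fin n) → Dec (∀ i j → f i ≡ f j → i ≡ j)
  injective? f = all? λ i → all? λ j → (f i ≟ f j) →-dec (i ≟ j)

  -- Taken against `init`, it counts the facilities away from home: the measure on which `separate`
  -- terminates.
  count≢ : (f g : Fin m → Fin n) → ℕ
  count≢ {zero}  f g = 0
  count≢ {suc m} f g with f zero ≟ g zero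
  ... | yes _ = count≢ (λ i → f (suc i)) (λ i → g (suc i))
  ... | no  _ = suc (count≢ (λ i → f (suc i)) (λ i → g (suc i)))

  _[_↦_] : {A : Set} → (Fin m → A) → Fin m → A → Fin m → A
  f [ i ↦ x ] = updateAt f i (const x)

  module _ {A : Set} (f : Fin m → A) (i : Fin m) (x : A) where

    update-same : (f [ i ↦ x ]) i ≡ x
    update-same = updateAt-updates i f

    update-other : ∀ {l} → l ≢ i → (f [ i ↦ x ]) l ≡ f l
    update-other {l} l≢i = updateAt-minimal l i f l≢i

  count≢-≤ : (f f′ g : Fin m → Fin n) → (∀ l → f′ l ≡ f l ⊎ f′ l ≡ g l) → count≢ f′ g ℕ.≤ count≢ f g
  count≢-≤ {zero}  f f′ g h = z≤n
  count≢-≤ {suc m} f f′ g h with f zero ≟ g zero | f′ zero ≟ g zero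
    | count≢-≤ (λ i → f (suc i)) (λ i → f′ (suc i)) (λ i → g (suc i)) (λ l → h (suc l))
  ... | yes p | yes q | le = le
  ... | no ¬p | yes q | le = ℕP.m≤n⇒m≤1+n le
  ... | no ¬p | no ¬q | le = s≤s le
  ... | yes p | no ¬q | le with h zero
  ...   | inj₁ e = ⊥-elim (¬q (trans e p))
  ...   | inj₂ e = ⊥-elim (¬q e)

  count≢-< : (f f′ g : Fin m → Fin n) → (∀ l → f′ l ≡ f l ⊎ f′ l ≡ g l) →
             ∀ i → f i ≢ g i → f′ i ≡ g i → count≢ f′ g ℕ.< count≢ f g
  count≢-< {suc m} f f′ g h zero ne e with f zero ≟ g zero | f′ zero ≟ g zero
    | count≢-≤ (λ i → f (suc i)) (λ i → f′ (suc i)) (λ i → g (suc i)) (λ l → h (suc l))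
  ... | yes p | _     | le = ⊥-elim (ne p)
  ... | no _  | no ¬q | le = ⊥-elim (¬q e)
  ... | no _  | yes _ | le = s≤s le
  count≢-< {suc m} f f′ g h (suc i) ne e with f zero ≟ g zero | f′ zero ≟ g zero
    | count≢-< (λ i → f (suc i)) (λ i → f′ (suc i)) (λ i → g (suc i)) (λ l → h (suc l)) i ne e
  ... | yes p | yes q | lt = lt
  ... | no ¬p | yes q | lt = ℕP.m≤n⇒m≤1+n lt
  ... | no ¬p | no ¬q | lt = s≤s lt
  ... | yes p | no ¬q | lt with h zero
  ...   | inj₁ e′ = ⊥-elim (¬q (trans e′ p))
  ...   | inj₂ e′ = ⊥-elim (¬q e′)

open FiniteMaps

-- Local optimality of a set, extended to all solutions keeping all but one location.

module LocationSets (I : Instance) where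
  open Instance I
  open IsMetric metric

  K : Set
  K = Fin (suc k')

  _Covers_ : (s′ s : K → Fin n) → Set
  s′ Covers s = ∀ u → ∃ λ l → s′ l ≡ s u

  -- All solutions have `suc k'` facilities, so an injective `s′` related in this way to an
  -- injective `s` differs from it, as a set, by at most one swap closing `s t`.
  _CoversExcept_ : (s′ : K → Fin n) → (s : K → Fin n) → K → Set
  (s′ CoversExcept s) t = ∀ u → u ≢ t → ∃ λ l → s′ l ≡ s u

  movementCost-cong : ∀ {s s′} → (∀ i → s i ≡ s′ i) → movementCost I s ≡ movementCost I s′
  movementCost-cong eq = sum-cong (λ i → cong (λ v → weight i * c (init i) v) (eq i))

  assignmentCost-cong : ∀ {s s′} → (∀ i → s i ≡ s′ i) → assignmentCost I s ≡ assignmentCost I s′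
  assignmentCost-cong eq =
    sum-cong (λ j → cong (ℕtoℚ (demand j) *_) (minℚ-cong (λ t → cong (c j) (eq t))))

  solutionCost-cong : ∀ {s s′} → (∀ i → s i ≡ s′ i) → solutionCost I s ≡ solutionCost I s′
  solutionCost-cong {s} {s′} eq =
    cong₂ _+_ (movementCost-cong {s} {s′} eq) (assignmentCost-cong {s} {s′} eq)

  assignmentCost-reassign : ∀ s′ (bound : Fin n → ℚ) → (∀ j → ∃ λ l → c j (s′ l) ≤ bound j) →
                            assignmentCost I s′ ≤ sumℚ (λ j → ℕtoℚ (demand j) * bound j)
  assignmentCost-reassign s′ bound near = sum-mono λ j →
    *-monoʳ (ℕtoℚ-nonneg (demand j))
      (ℚP.≤-trans (minℚ-≤ (λ t → c j (s′ t)) (proj₁ (near j))) (proj₂ (near j)))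

  assignmentCost-covers : ∀ {s s′} → s′ Covers s → assignmentCost I s′ ≤ assignmentCost I s
  assignmentCost-covers {s} {s′} cov =
    assignmentCost-reassign s′ (λ j → minℚ (λ t → c j (s t))) near
    where
    near : ∀ j → ∃ λ l → c j (s′ l) ≤ minℚ (λ t → c j (s t))
    near j with minℚ-attained (λ t → c j (s t))
    ... | t , eq with cov t
    ...   | l , eq′ = l , ℚP.≤-reflexive (trans (cong (c j) eq′) (sym eq))

  -- A facility sharing its final location with another one can stay home instead:
  -- no location is lost and its movement cost vanishes.
  separate : ∀ s′ → ∃ λ s″ → Injective _≡_ _≡_ s″ × s″ Covers s′ × solutionCost I s″ ≤ solutionCost I s′
  separate s′ = go s′ (ℕI.<-wellFounded (count≢ s′ init))
    where
    -- Since `init` is injective, two facilities at one location cannot both be at home.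
    collision : ∀ (s : K → Fin n) → ¬ (∀ i j → s i ≡ s j → i ≡ j) →
                ∃ λ i → ∃ λ j → s i ≡ s j × i ≢ j × s i ≢ init i
    collision s ¬inj with any? (λ i → any? (λ j → (s i ≟ s j) ×-dec (¬? (i ≟ j)) ×-dec (¬? (s i ≟ init i))))
    ... | yes (i , j , p) = i , j , p
    ... | no ¬p = ⊥-elim (¬inj injective)
      where
      injective : ∀ i j → s i ≡ s j → i ≡ j
      injective i j eq with i ≟ j | s i ≟ init i | s j ≟ init j
      ... | yes i≡j | _ | _ = i≡j
      ... | no i≢j  | no away | _ = ⊥-elim (¬p (i , j , eq , i≢j , away))
      ... | no i≢j  | yes _ | no away = ⊥-elim (¬p (j , i , sym eq , (λ e → i≢j (sym e)) , away))
      ... | no _    | yes home | yes home′ = init-inj (trans (sym home) (trans eq home′))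

    go : ∀ s → Acc ℕ._<_ (count≢ s init) →
         ∃ λ s″ → Injective _≡_ _≡_ s″ × s″ Covers s × solutionCost I s″ ≤ solutionCost I s
    go s (acc rec) with injective? s
    ... | yes inj = s , inj _ _ , (λ u → u , refl) , ℚP.≤-refl
    ... | no ¬inj with collision s ¬inj
    ...   | i , j , si≡sj , i≢j , away =
      let s″ , inj , cov , le = go s₁ (rec (count≢-< s s₁ init changed i away (update-same s i (init i))))
      in  s″ , inj , covers-trans cov
          , ℚP.≤-trans le (sum-mono cheaper ⊕ assignmentCost-covers {s} {s₁} covers₁)
      where
      s₁ = s [ i ↦ init i ]
      changed : ∀ l → s₁ l ≡ s l ⊎ s₁ l ≡ init l
      changed l with l ≟ i
      ... | yes refl = inj₂ (update-same s i (init i))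
      ... | no l≢i   = inj₁ (update-other s i (init i) l≢i)
      covers₁ : s₁ Covers s
      covers₁ u with u ≟ i
      ... | yes refl = j , trans (update-other s i (init i) (λ e → i≢j (sym e))) (sym si≡sj)
      ... | no u≢i   = u , update-other s i (init i) u≢i
      covers-trans : ∀ {s″} → s″ Covers s₁ → s″ Covers s
      covers-trans cov u with covers₁ u
      ... | l , eq with cov l
      ...   | l′ , eq′ = l′ , trans eq′ eq
      cheaper : ∀ l → weight l * c (init l) (s₁ l) ≤ weight l * c (init l) (s l)
      cheaper l with changed l
      ... | inj₁ eq = ℚP.≤-reflexive (cong (λ v → weight l * c (init l) v) eq)
      ... | inj₂ eq = *-monoʳ (weight-nonneg l)
        (ℚP.≤-trans (ℚP.≤-reflexive (trans (cong (c (init l)) eq) (self-zero (init l)))) (nonneg _ _))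

  -- `IsSwapLocalOpt` only compares values known to be set costs, so the swapped set needs one. The
  -- search runs over the codes of all self-maps of `K` and keeps the injective ones.
  setCost-exists : ∀ T → ∃ (IsSetCost I T)
  setCost-exists T = cost e , (ρ , solutionCost-cong (λ i → cong T (sym (ρ≡ i)))) , minimal
    where
    cost : Fin (suc k' ℕ.^ suc k') → ℚ
    cost e = solutionCost I (λ i → T (finToFun e i))
    code-injective : (ρ : Permutation′ (suc k')) → ∀ i j →
                     finToFun (funToFin (ρ ⟨$⟩ʳ_)) i ≡ finToFun (funToFin (ρ ⟨$⟩ʳ_)) j → i ≡ j
    code-injective ρ i j eq = permutation-injective ρ
      (trans (sym (finToFun-funToFin (ρ ⟨$⟩ʳ_) i)) (trans eq (finToFun-funToFin (ρ ⟨$⟩ʳ_) j)))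
    best = argmin-on (λ e → injective? (finToFun {suc k'} {suc k'} e)) cost
             (_ , code-injective Perm.id)
    e = proj₁ best
    ρ-spec = injective⇒permutation {f = finToFun e} (λ {i} {j} → proj₁ (proj₂ best) i j)
    ρ = proj₁ ρ-spec
    ρ≡ = proj₂ ρ-spec
    minimal : ∀ π → cost e ≤ solutionCost I (λ i → T (π ⟨$⟩ʳ i))
    minimal π = ℚP.≤-trans (proj₂ (proj₂ best) _ (code-injective π))
      (ℚP.≤-reflexive (solutionCost-cong (λ i → cong T (finToFun-funToFin (π ⟨$⟩ʳ_) i))))

  module _ (S : K → Fin n) (S-inj : Injective _≡_ _≡_ S) (locOpt : IsSwapLocalOpt I S)
           (x : ℚ) (isCost : IsSetCost I S x) where

    private
      -- Here `θ` picks for each location of `T` a facility of `s″` placed there. Being injective on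
      -- a finite type it is a permutation, and its inverse is a matching to `T` that realises `s″`.
      reindex-≤ : ∀ {T y s″} → IsSetCost I T y → (θ : K → K) → Injective _≡_ _≡_ θ →
                  (∀ u → s″ (θ u) ≡ T u) → y ≤ solutionCost I s″
      reindex-≤ {T} {y} {s″} isCostT θ θ-inj eq =
        ℚP.≤-trans (proj₂ isCostT (flip ρ)) (ℚP.≤-reflexive (solutionCost-cong same))
        where
        ρ = proj₁ (injective⇒permutation θ-inj)
        same : ∀ i → T (flip ρ ⟨$⟩ʳ i) ≡ s″ i
        same i = trans (sym (eq (ρ ⟨$⟩ˡ i)))
          (cong s″ (trans (sym (proj₂ (injective⇒permutation θ-inj) (ρ ⟨$⟩ˡ i))) (inverseʳ ρ)))

      module NewLocation (s″ : K → Fin n) (t : K) (cov : (s″ CoversExcept S) t)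
                         (l₀ : K) (new : ∀ u → S u ≢ s″ l₀) where
        T : K → Fin n
        T = swap I S t (s″ l₀)

        preimage : ∀ u → ∃ λ l → s″ l ≡ T u
        preimage u with u ≟ t
        ... | yes _   = l₀ , refl
        ... | no u≢t = cov u u≢t

        T-inj : ∀ u v → T u ≡ T v → u ≡ v
        T-inj u v eq with u ≟ t | v ≟ t
        ... | yes p | yes q = trans p (sym q)
        ... | yes p | no _  = ⊥-elim (new v (sym eq))
        ... | no _  | yes q = ⊥-elim (new u eq)
        ... | no _  | no _  = S-inj eq

        θ-inj : Injective _≡_ _≡_ (λ u → proj₁ (preimage u))
        θ-inj {u} {v} eq =
          T-inj u v (trans (sym (proj₂ (preimage u))) (trans (cong s″ eq) (proj₂ (preimage v))))

        bound : x ≤ solutionCost I s″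
        bound = ℚP.≤-trans
          (ℚP.≮⇒≥ (locOpt t (s″ l₀) new x _ isCost (proj₂ (setCost-exists T))))
          (reindex-≤ (proj₂ (setCost-exists T)) (λ u → proj₁ (preimage u)) θ-inj (λ u → proj₂ (preimage u)))

      module OldLocations (s″ : K → Fin n) (s″-inj : Injective _≡_ _≡_ s″)
                          (index : ∀ l → ∃ λ u → S u ≡ s″ l) where
        ι : K → K
        ι l = proj₁ (index l)

        ι-inj : Injective _≡_ _≡_ ι
        ι-inj {l} {l′} eq = s″-inj (trans (sym (proj₂ (index l))) (trans (cong S eq) (proj₂ (index l′))))

        θ : K → K
        θ u = proj₁ (injective⇒surjective ι-inj u)

        ι∘θ : ∀ u → ι (θ u) ≡ u
        ι∘θ u = proj₂ (injective⇒surjective ι-inj u)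

        bound : x ≤ solutionCost I s″
        bound = reindex-≤ isCost θ
          (λ {u} {v} eq → trans (sym (ι∘θ u)) (trans (cong ι eq) (ι∘θ v)))
          (λ u → trans (sym (proj₂ (index (θ u)))) (cong S (ι∘θ u)))

    -- If `s″` uses a location outside `S`, it is a matching to a swapped set and local optimality
    -- applies. Otherwise `s″` permutes `S`, and `x` is minimal over matchings.
    localOpt-injective : ∀ s″ t → Injective _≡_ _≡_ s″ → (s″ CoversExcept S) t → x ≤ solutionCost I s″
    localOpt-injective s″ t s″-inj cov = decide (any? (λ l → all? (λ u → ¬? (S u ≟ s″ l))))
      where
      decide : Dec (∃ λ l → ∀ u → S u ≢ s″ l) → x ≤ solutionCost I s″
      decide (yes (l₀ , new)) = NewLocation.bound s″ t cov l₀ new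
      decide (no ¬new) = OldLocations.bound s″ s″-inj λ l →
        decidable-stable (any? (λ u → S u ≟ s″ l)) (λ ¬p → ¬new (l , λ u eq → ¬p (u , eq)))

    -- Later exchanges may put two facilities at one location, for instance when the location to be
    -- opened is already in use; `separate` resolves this at no extra cost.
    localOpt-covers : ∀ s′ t → (s′ CoversExcept S) t → x ≤ solutionCost I s′
    localOpt-covers s′ t cov =
      ℚP.≤-trans (localOpt-injective (proj₁ sep) t (proj₁ (proj₂ sep)) cov′) (proj₂ (proj₂ (proj₂ sep)))
      where
      sep = separate s′
      cov′ : (proj₁ sep CoversExcept S) t
      cov′ u u≢t =
        let l , eq = cov u u≢t
            l′ , eq′ = proj₁ (proj₂ (proj₂ sep)) l
        in  l′ , trans eq′ eq

-- Comparison of a locally optimal `s` with a fixed solution `o`.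

module Exchange (I : Instance) (s : Fin (k I) → Fin (Instance.n I)) (s-inj : Injective _≡_ _≡_ s)
  (o : Fin (k I) → Fin (Instance.n I))
  (localOpt : ∀ s′ t → LocationSets._CoversExcept_ I s′ s t → solutionCost I s ≤ solutionCost I s′)
  (d : Fin (Instance.n I) → ℚ) (d-def : ∀ j → ℕtoℚ (Instance.demand I j) ≡ d j) where

  open Instance I
  open IsMetric metric
  open LocationSets I

  w : K → ℚ
  w = weight

  d-nonneg : ∀ j → 0ℚ ≤ d j
  d-nonneg j = subst (0ℚ ≤_) (d-def j) (ℕtoℚ-nonneg (demand j))

  nearest : (t : K → Fin n) → Fin n → K
  nearest t v = proj₁ (minℚ-attained (λ l → c v (t l)))

  nearest-≤ : ∀ (t : K → Fin n) v l → c v (t (nearest t v)) ≤ c v (t l)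
  nearest-≤ t v l = ℚP.≤-trans (ℚP.≤-reflexive (sym (proj₂ (minℚ-attained (λ l → c v (t l))))))
                               (minℚ-≤ (λ l → c v (t l)) l)

  σ τ : Fin n → K
  σ = nearest s
  τ = nearest o

  η : K → K
  η p = nearest s (o p)

  Sdist Odist : Fin n → ℚ
  Sdist j = c j (s (σ j))
  Odist j = c j (o (τ j))

  moved moved* gap : K → ℚ
  moved  l = c (init l) (s l)
  moved* l = c (init l) (o l)
  gap    l = c (o l) (s (η l))

  -- Movement cost saved by a shift of facility `l` along its link; it may be negative.
  γ : K → ℚ
  γ l = w l * (moved l - c (init l) (s (η l)))

  saving : K → ℚ
  saving i = sumℚ (λ j → when (τ j ≟ i) (d j * (Sdist j - Odist j)))

  -- Gross gain of sending facility `i` to `o i`: the loss caused by closing a location is not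
  -- deducted.
  h : K → ℚ
  h i = w i * (moved i - moved* i) + saving i

  -- `q` and `r` group the optimal assignment cost by current and by optimal location. `captured a`
  -- is the demand at `s a` for which the detour through the optimal location leads back to `s a`.
  q r captured : K → ℚ
  q a = sumℚ (λ j → when (σ j ≟ a) (d j * Odist j))
  r i = sumℚ (λ j → when (τ j ≟ i) (d j * Odist j))
  captured a = sumℚ (λ j → when (σ j ≟ a) (when (η (τ j) ≟ a) (d j)))

  Odist-nonneg : ∀ j → 0ℚ ≤ Odist j
  Odist-nonneg j = nonneg _ _

  dO-nonneg : ∀ j → 0ℚ ≤ d j * Odist j
  dO-nonneg j = *-nonneg (d-nonneg j) (Odist-nonneg j)

  q-nonneg : ∀ a → 0ℚ ≤ q a
  q-nonneg a = sum-nonneg (λ j → when-nonneg (σ j ≟ a) (λ _ → dO-nonneg j))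

  r-nonneg : ∀ i → 0ℚ ≤ r i
  r-nonneg i = sum-nonneg (λ j → when-nonneg (τ j ≟ i) (λ _ → dO-nonneg j))

  captured-nonneg : ∀ a → 0ℚ ≤ captured a
  captured-nonneg a = sum-nonneg (λ j → when-nonneg (σ j ≟ a) (λ _ → when-nonneg (η (τ j) ≟ a) (λ _ → d-nonneg j)))

  -- The exchange inequality of a single swap.

  movementCost-update : ∀ (t : K → Fin n) i v → movementCost I (t [ i ↦ v ]) + w i * c (init i) (t i)
                                ≡ movementCost I t + w i * c (init i) v
  movementCost-update t i v = begin
    movementCost I (t [ i ↦ v ]) + w i * c (init i) (t i)
      ≡⟨ cong (movementCost I (t [ i ↦ v ]) +_) (sym (sum-when (λ l → w l * c (init l) (t l)) i)) ⟩
    movementCost I (t [ i ↦ v ]) + sumℚ old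
      ≡⟨ sym (sum-+ (λ l → w l * c (init l) ((t [ i ↦ v ]) l)) old) ⟩
    sumℚ (λ l → w l * c (init l) ((t [ i ↦ v ]) l) + old l)
      ≡⟨ sum-cong pointwise ⟩
    sumℚ (λ l → w l * c (init l) (t l) + new l)
      ≡⟨ sum-+ (λ l → w l * c (init l) (t l)) new ⟩
    movementCost I t + sumℚ new
      ≡⟨ cong (movementCost I t +_) (sum-when (λ l → w l * c (init l) v) i) ⟩
    movementCost I t + w i * c (init i) v ∎
    where
    open ≡-Reasoning
    old new : K → ℚ
    old l = when (l ≟ i) (w l * c (init l) (t l))
    new l = when (l ≟ i) (w l * c (init l) v)
    pointwise : ∀ l → w l * c (init l) ((t [ i ↦ v ]) l) + old l ≡ w l * c (init l) (t l) + new l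
    pointwise l with l ≟ i
    ... | yes refl = trans (cong (λ u → w l * c (init l) u + w l * c (init l) (t l)) (update-same t l v))
                           (ℚP.+-comm (w l * c (init l) v) _)
    ... | no l≢i   = cong (λ u → w l * c (init l) u + 0ℚ) (update-other t i v l≢i)

  assignmentCost-s : assignmentCost I s ≡ sumℚ (λ j → d j * Sdist j)
  assignmentCost-s = sum-cong (λ j → cong₂ _*_ (d-def j) (proj₂ (minℚ-attained (λ l → c j (s l)))))

  assignmentCost-o : assignmentCost I o ≡ sumℚ (λ j → d j * Odist j)
  assignmentCost-o = sum-cong (λ j → cong₂ _*_ (d-def j) (proj₂ (minℚ-attained (λ l → c j (o l)))))

  -- Closing a and opening o i: clients of o i go there, the other clients of a go to
  -- the location of s nearest to their optimal location, unless that location is a itself.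
  module _ (s′ : K → Fin n) (a i : K) (X : ℚ) (0≤X : 0ℚ ≤ X)
           (cov : (s′ CoversExcept s) a) (opened : ∃ λ l → s′ l ≡ o i)
           (far : ∀ j → σ j ≡ a → τ j ≢ i → η (τ j) ≡ a →
                  ∃ λ l → c j (s′ l) ≤ Sdist j + (Odist j + Odist j + X)) where

    private
      detour : Fin n → ℚ
      detour j = when (σ j ≟ a) (Odist j + Odist j + when (η (τ j) ≟ a) X)

      bound : ∀ j → Dec (τ j ≡ i) → ℚ
      bound j (yes _) = Odist j
      bound j (no _)  = Sdist j + detour j

      near : ∀ j (τ? : Dec (τ j ≡ i)) → ∃ λ l → c j (s′ l) ≤ bound j τ?
      near j (yes refl) = proj₁ opened , ℚP.≤-reflexive (cong (c j) (proj₂ opened))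
      near j (no τj≢i) with σ j ≟ a
      ... | no σj≢a = let l , eq = cov (σ j) σj≢a in
        l , ℚP.≤-reflexive (trans (cong (c j) eq) (sym (ℚP.+-identityʳ _)))
      ... | yes σj≡a with η (τ j) ≟ a
      ...   | yes ητj≡a = far j σj≡a τj≢i ητj≡a
      -- Detour through the optimal location: `s (η (τ j))` is no farther from `o (τ j)` than
      -- `s (σ j)`, so two triangle inequalities give at most `Sdist j` plus twice `Odist j`.
      ...   | no ητj≢a = let l , eq = cov (η (τ j)) ητj≢a in
        l , ℚP.≤-trans (ℚP.≤-reflexive (cong (c j) eq))
          (≤-by (triangle j (o (τ j)) (s (η (τ j))) ⊕ nearest-≤ s (o (τ j)) (σ j)
                 ⊕ triangle (o (τ j)) j (s (σ j)) ⊕ ℚP.≤-reflexive (symmetric (o (τ j)) j))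
            (solve 6 (λ js jo os oσ oj S →
               js :+ (jo :+ os :+ (oσ :+ (oj :+ S :+ jo))) := S :+ (jo :+ jo :+ con 0ℚ) :+ (js :+ (os :+ (oσ :+ oj)))) refl
               (c j (s (η (τ j)))) (Odist j) (c (o (τ j)) (s (η (τ j)))) (c (o (τ j)) (s (σ j))) (c (o (τ j)) j) (Sdist j)))

      pointwise : ∀ j (τ? : Dec (τ j ≡ i)) →
        d j * bound j τ? + when τ? (d j * (Sdist j - Odist j))
          ≤ d j * Sdist j + (when (σ j ≟ a) (d j * Odist j) + (when (σ j ≟ a) (d j * Odist j)
              + when (σ j ≟ a) (when (η (τ j) ≟ a) (d j)) * X))
      pointwise j (yes _) = ≤-by (+-nonneg (when-nonneg (σ j ≟ a) (λ _ → dO-nonneg j))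
                                  (+-nonneg (when-nonneg (σ j ≟ a) (λ _ → dO-nonneg j))
                                   (*-nonneg (when-nonneg (σ j ≟ a) (λ _ → when-nonneg (η (τ j) ≟ a) (λ _ → d-nonneg j))) 0≤X)))
        (solve 6 (λ d S O x y z → d :* O :+ d :* (S :- O) :+ (x :+ (y :+ z)) := d :* S :+ (x :+ (y :+ z)) :+ con 0ℚ) refl
          (d j) (Sdist j) (Odist j) (when (σ j ≟ a) (d j * Odist j)) (when (σ j ≟ a) (d j * Odist j))
          (when (σ j ≟ a) (when (η (τ j) ≟ a) (d j)) * X))
      pointwise j (no _) with σ j ≟ a | η (τ j) ≟ a
      ... | yes _ | yes _ = ℚP.≤-reflexive
        (solve 4 (λ d S O X → d :* (S :+ (O :+ O :+ X)) :+ con 0ℚ := d :* S :+ (d :* O :+ (d :* O :+ d :* X))) refl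
          (d j) (Sdist j) (Odist j) X)
      ... | yes _ | no _ = ℚP.≤-reflexive
        (solve 4 (λ d S O X → d :* (S :+ (O :+ O :+ con 0ℚ)) :+ con 0ℚ := d :* S :+ (d :* O :+ (d :* O :+ con 0ℚ :* X))) refl
          (d j) (Sdist j) (Odist j) X)
      ... | no _ | _ = ℚP.≤-reflexive
        (solve 3 (λ d S X → d :* (S :+ con 0ℚ) :+ con 0ℚ := d :* S :+ (con 0ℚ :+ (con 0ℚ :+ con 0ℚ :* X))) refl
          (d j) (Sdist j) X)

      total : sumℚ (λ j → d j * bound j (τ j ≟ i)) + saving i
              ≤ sumℚ (λ j → d j * Sdist j) + (q a + (q a + captured a * X))
      total = begin
        sumℚ (λ j → d j * bound j (τ j ≟ i)) + saving i
          ≡⟨ sym (sum-+ (λ j → d j * bound j (τ j ≟ i)) (λ j → when (τ j ≟ i) (d j * (Sdist j - Odist j)))) ⟩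
        sumℚ (λ j → d j * bound j (τ j ≟ i) + when (τ j ≟ i) (d j * (Sdist j - Odist j)))
          ≤⟨ sum-mono (λ j → pointwise j (τ j ≟ i)) ⟩
        sumℚ (λ j → d j * Sdist j + (qa j + (qa j + cap j * X)))
          ≡⟨ sum-+ (λ j → d j * Sdist j) (λ j → qa j + (qa j + cap j * X)) ⟩
        sumℚ (λ j → d j * Sdist j) + sumℚ (λ j → qa j + (qa j + cap j * X))
          ≡⟨ cong (sumℚ (λ j → d j * Sdist j) +_) (trans (sum-+ qa (λ j → qa j + cap j * X))
               (cong (q a +_) (trans (sum-+ qa (λ j → cap j * X)) (cong (q a +_) (sum-*ʳ cap X))))) ⟩
        sumℚ (λ j → d j * Sdist j) + (q a + (q a + captured a * X)) ∎
        where
        open ≤-Reasoning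
        qa cap : Fin n → ℚ
        qa j  = when (σ j ≟ a) (d j * Odist j)
        cap j = when (σ j ≟ a) (when (η (τ j) ≟ a) (d j))

    exchange : movementCost I s - movementCost I s′ + saving i ≤ q a + q a + captured a * X
    exchange = ≤-by
      (localOpt s′ a cov ⊕ assignmentCost-reassign s′ (λ j → bound j (τ j ≟ i)) (λ j → near j (τ j ≟ i))
        ⊕ ℚP.≤-reflexive (sum-cong (λ j → cong (_* bound j (τ j ≟ i)) (d-def j)))
        ⊕ total ⊕ ℚP.≤-reflexive (sym assignmentCost-s))
      (solve 10 (λ M M′ A A′ sv B B′ D q cX →
          M :- M′ :+ sv :+ (M′ :+ A′ :+ (B′ :+ (B :+ (D :+ (q :+ (q :+ cX)) :+ A))))
            := q :+ q :+ cX :+ (M :+ A :+ (A′ :+ (B′ :+ (B :+ sv :+ D))))) refl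
        (movementCost I s) (movementCost I s′) (assignmentCost I s) (assignmentCost I s′) (saving i)
        (sumℚ (λ j → d j * bound j (τ j ≟ i))) (sumℚ (λ j → ℕtoℚ (demand j) * bound j (τ j ≟ i)))
        (sumℚ (λ j → d j * Sdist j)) (q a) (captured a * X))

  -- Walks along `η` and the shifts they induce.

  walk : K → ℕ → K
  walk a zero    = a
  walk a (suc t) = η (walk a t)

  Simple : K → ℕ → Set
  Simple a zero    = ⊤
  Simple a (suc t) = Simple a t × (∀ i → i ℕ.≤ t → walk a i ≢ walk a (suc t))

  gain : K → ℕ → ℚ
  gain a zero    = 0ℚ
  gain a (suc t) = gain a t + γ (walk a t)

  -- On a simple walk with `t` positive, `s a` is vacated and facility `walk a t` shares its
  -- location with the facility before it, so it is free to move on.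
  shifted : K → ℕ → K → Fin n
  shifted a zero    = s
  shifted a (suc t) = shifted a t [ walk a t ↦ s (walk a (suc t)) ]

  shifted-unvisited : ∀ a t l → (∀ i → i ℕ.< t → walk a i ≢ l) → shifted a t l ≡ s l
  shifted-unvisited a zero    l new = refl
  shifted-unvisited a (suc t) l new =
    trans (update-other (shifted a t) (walk a t) (s (walk a (suc t))) (λ e → new t ℕP.≤-refl (sym e)))
          (shifted-unvisited a t l (λ i i<t → new i (ℕP.m≤n⇒m≤1+n i<t)))

  shifted-end : ∀ a t → Simple a t → shifted a t (walk a t) ≡ s (walk a t)
  shifted-end a zero    _             = refl
  shifted-end a (suc t) (_ , new) =
    shifted-unvisited a (suc t) (walk a (suc t)) (λ { i (s≤s i≤t) → new i i≤t })

  shifted-covers : ∀ a t → Simple a t → ∀ u → u ≢ a → ∃ λ l → l ≢ walk a t × shifted a t l ≡ s u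
  shifted-covers a zero    _ u u≢a = u , u≢a , refl
  shifted-covers a (suc t) (simple , new) u u≢a with u ≟ walk a (suc t)
  ... | yes refl = walk a t , new t ℕP.≤-refl , update-same (shifted a t) (walk a t) (s (walk a (suc t)))
  ... | no u≢end with shifted-covers a t simple u u≢a
  ...   | l , l≢ , eq = l , l≢end , trans (update-other (shifted a t) (walk a t) (s (walk a (suc t))) l≢) eq
    where
    -- The new end has not been moved yet and still sits at its own location, so it could cover
    -- `s u` only if it were `u`.
    l≢end : l ≢ walk a (suc t)
    l≢end refl = u≢end (sym (s-inj (trans
      (sym (shifted-unvisited a t l (λ i i<t → new i (ℕP.<⇒≤ i<t)))) eq)))

  -- The target `v` is a parameter so that a further shift and the final move to an optimal location
  -- are handled at once. By `shifted-end` the last facility still pays its original movement cost.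
  movementCost-shift : ∀ a t v → Simple a t →
    movementCost I (shifted a t) + gain a t ≡ movementCost I s →
    movementCost I (shifted a t [ walk a t ↦ v ])
      + (gain a t + w (walk a t) * (moved (walk a t) - c (init (walk a t)) v)) ≡ movementCost I s
  movementCost-shift a t v simple eq = begin
    M′ + (G + W * (m - m′))
      ≡⟨ solve 5 (λ M′ G W m m′ → M′ :+ (G :+ W :* (m :- m′)) := M′ :+ W :* m :+ (G :- W :* m′)) refl M′ G W m m′ ⟩
    M′ + W * m + (G - W * m′)
      ≡⟨ cong (λ x → M′ + W * c (init (walk a t)) x + (G - W * m′)) (sym (shifted-end a t simple)) ⟩
    M′ + W * c (init (walk a t)) (shifted a t (walk a t)) + (G - W * m′)
      ≡⟨ cong (_+ (G - W * m′)) (movementCost-update (shifted a t) (walk a t) v) ⟩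
    M + W * m′ + (G - W * m′)
      ≡⟨ solve 4 (λ M G W m′ → M :+ W :* m′ :+ (G :- W :* m′) := M :+ G) refl M G W m′ ⟩
    M + G
      ≡⟨ eq ⟩
    movementCost I s ∎
    where
    open ≡-Reasoning
    M′ = movementCost I (shifted a t [ walk a t ↦ v ])
    M  = movementCost I (shifted a t)
    G  = gain a t
    W  = w (walk a t)
    m  = moved (walk a t)
    m′ = c (init (walk a t)) v

  movementCost-shifted : ∀ a t → Simple a t → movementCost I (shifted a t) + gain a t ≡ movementCost I s
  movementCost-shifted a zero    _ = ℚP.+-identityʳ _
  movementCost-shifted a (suc t) (simple , _) =
    movementCost-shift a t (s (walk a (suc t))) simple (movementCost-shifted a t simple)

  val : K → ℕ → ℚ
  val a t = gain a t + h (walk a t)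

  private
    shiftAndOpen : K → ℕ → K → Fin n
    shiftAndOpen a t = shifted a t [ walk a t ↦ o (walk a t) ]

    shiftAndOpen-covers : ∀ a t → Simple a t → (shiftAndOpen a t CoversExcept s) a
    shiftAndOpen-covers a t simple u u≢a =
      let l , l≢ , eq = shifted-covers a t simple u u≢a
      in  l , trans (update-other (shifted a t) (walk a t) (o (walk a t)) l≢) eq

    shiftAndOpen-opens : ∀ a t → shiftAndOpen a t (walk a t) ≡ o (walk a t)
    shiftAndOpen-opens a t = update-same (shifted a t) (walk a t) (o (walk a t))

  -- This is `exchange` for the swap that closes `s a` and opens `o (walk a t)`; the shifts along
  -- the walk contribute `gain a t`.
  val-simple : ∀ a t → Simple a t → ∀ X → 0ℚ ≤ X →
    (∀ j → σ j ≡ a → τ j ≢ walk a t → η (τ j) ≡ a →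
       ∃ λ l → c j (shiftAndOpen a t l) ≤ Sdist j + (Odist j + Odist j + X)) →
    val a t ≤ q a + q a + captured a * X
  val-simple a t simple X 0≤X far = ≤-by
    (exchange (shiftAndOpen a t) a (walk a t) X 0≤X (shiftAndOpen-covers a t simple)
        (walk a t , shiftAndOpen-opens a t) far
      ⊕ ℚP.≤-reflexive (movementCost-shift a t (o (walk a t)) simple (movementCost-shifted a t simple)))
    (solve 6 (λ G W A M M′ Y → G :+ (W :+ A) :+ (Y :+ M) := Y :+ (M :- M′ :+ A :+ (M′ :+ (G :+ W)))) refl
      (gain a t) (w (walk a t) * (moved (walk a t) - moved* (walk a t))) (saving (walk a t))
      (movementCost I s) (movementCost I (shiftAndOpen a t)) (q a + q a + captured a * X))

  -- Shifting once around a cycle keeps every location open, so no client is worse off and local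
  -- optimality forbids saving movement cost.
  rotation : ∀ b t → Simple b t → walk b (suc t) ≡ b → gain b (suc t) ≤ 0ℚ
  rotation b t simple closed = ≤-by
    (localOpt (shifted b (suc t)) b (λ u _ → covers u)
      ⊕ assignmentCost-covers {s} {shifted b (suc t)} covers
      ⊕ ℚP.≤-reflexive (movementCost-shift b t (s (walk b (suc t))) simple (movementCost-shifted b t simple)))
    (solve 5 (λ G M M′ A A′ → G :+ (M′ :+ A′ :+ (A :+ M)) := con 0ℚ :+ (M :+ A :+ (A′ :+ (M′ :+ G)))) refl
      (gain b (suc t)) (movementCost I s) (movementCost I (shifted b (suc t)))
      (assignmentCost I s) (assignmentCost I (shifted b (suc t))))
    where
    covers : shifted b (suc t) Covers s
    covers u with u ≟ b
    ... | yes refl = walk b t , trans (update-same (shifted b t) (walk b t) (s (walk b (suc t)))) (cong s closed)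
    ... | no u≢b with shifted-covers b t simple u u≢b
    ...   | l , l≢ , eq = l , trans (update-other (shifted b t) (walk b t) (s (walk b (suc t))) l≢) eq

  -- Excision of cycles from walks.

  walk-+ : ∀ a i t → walk (walk a i) t ≡ walk a (t ℕ.+ i)
  walk-+ a i zero    = refl
  walk-+ a i (suc t) = cong η (walk-+ a i t)

  gain-+ : ∀ a i t → gain a (t ℕ.+ i) ≡ gain a i + gain (walk a i) t
  gain-+ a i zero    = sym (ℚP.+-identityʳ _)
  gain-+ a i (suc t) = trans (cong₂ _+_ (gain-+ a i t) (cong γ (sym (walk-+ a i t)))) (ℚP.+-assoc (gain a i) _ _)

  simple-suffix : ∀ a i t → Simple a (t ℕ.+ i) → Simple (walk a i) t
  simple-suffix a i zero    _ = tt
  simple-suffix a i (suc t) (simple , new) = simple-suffix a i t simple , λ l l≤t eq →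
    new (l ℕ.+ i) (ℕP.+-monoˡ-≤ i l≤t) (trans (sym (walk-+ a i l)) (trans eq (walk-+ a i (suc t))))

  simple-distinct : ∀ a t → Simple a t → ∀ {i j} → i ℕ.< j → j ℕ.≤ t → walk a i ≢ walk a j
  simple-distinct a zero    _ i<j j≤0 = ⊥-elim (ℕP.<⇒≱ (ℕP.≤-trans i<j j≤0) z≤n)
  simple-distinct a (suc t) (simple , new) {i} {j} i<j j≤ with ℕP.m≤n⇒m<n∨m≡n j≤
  ... | inj₁ (s≤s j≤t) = simple-distinct a t simple i<j j≤t
  ... | inj₂ refl      = new i (ℕP.≤-pred i<j)

  simple-bounded : ∀ a t → Simple a t → t ℕ.≤ k'
  simple-bounded a t simple = ℕP.≮⇒≥ λ k'<t →
    let i , j , i<j , eq = pigeonhole (s≤s k'<t) (λ (l : Fin (suc t)) → walk a (toℕ l))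
    in  simple-distinct a t simple i<j (toℕ≤pred[n] j) eq

  -- The walk consists of `i` steps, a cycle of `suc m` links at `walk a i`, and `r` further steps.
  -- The index is written as this sum so that matching exposes the decomposition.
  data Repeats (a : K) : ℕ → Set where
    repeats : ∀ i m r → Simple a (m ℕ.+ i) → walk a i ≡ walk a (suc (m ℕ.+ i)) →
              Repeats a (r ℕ.+ suc (m ℕ.+ i))

  simple⊎repeats : ∀ a t → Simple a t ⊎ Repeats a t
  simple⊎repeats a zero = inj₁ tt
  simple⊎repeats a (suc t) with simple⊎repeats a t
  ... | inj₂ (repeats i m r simple eq) = inj₂ (repeats i m (suc r) simple eq)
  ... | inj₁ simple with ℕP.anyUpTo? (λ i → walk a i ≟ walk a (suc t)) (suc t)
  ...   | no ¬p = inj₁ (simple , λ i i≤t eq → ¬p (i , s≤s i≤t , eq))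
  ...   | yes (i , s≤s i≤t , eq) = inj₂ (first (ℕP.m∸n+n≡m i≤t) simple eq)
    where
    first : ∀ {m} → m ℕ.+ i ≡ t → Simple a t → walk a i ≡ walk a (suc t) → Repeats a (suc t)
    first {m} refl = repeats i m 0

  -- The removed cycle has gain at most 0 by `rotation`, and the remaining steps continue from the
  -- same node.
  val-excise : ∀ a i m r → Simple a (m ℕ.+ i) → walk a i ≡ walk a (suc (m ℕ.+ i)) →
               val a (r ℕ.+ suc (m ℕ.+ i)) ≤ val a (r ℕ.+ i)
  val-excise a i m r simple eq = begin
    val a (r ℕ.+ suc (m ℕ.+ i))
      ≡⟨ split (suc (m ℕ.+ i)) ⟩
    gain a (suc m ℕ.+ i) + (gain (walk a (suc (m ℕ.+ i))) r + h (walk (walk a (suc (m ℕ.+ i))) r))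
      ≡⟨ cong₂ (λ x b → x + (gain b r + h (walk b r))) (gain-+ a i (suc m)) (sym eq) ⟩
    gain a i + gain (walk a i) (suc m) + rest
      ≤⟨ ≤-by (rotation (walk a i) m (simple-suffix a i m simple) (trans (walk-+ a i (suc m)) (sym eq)))
          (solve 3 (λ x y z → x :+ y :+ z :+ con 0ℚ := x :+ z :+ y) refl (gain a i) (gain (walk a i) (suc m)) rest) ⟩
    gain a i + rest
      ≡⟨ sym (split i) ⟩
    val a (r ℕ.+ i) ∎
    where
    open ≤-Reasoning
    rest = gain (walk a i) r + h (walk (walk a i) r)
    split : ∀ t → val a (r ℕ.+ t) ≡ gain a t + (gain (walk a t) r + h (walk (walk a t) r))
    split t = trans (cong₂ _+_ (gain-+ a t r) (cong h (sym (walk-+ a t r)))) (ℚP.+-assoc (gain a t) _ _)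

  -- Each excision shortens the walk, so repeating it ends at a simple one.
  val-≤-simple : ∀ a t → ∃ λ t′ → Simple a t′ × val a t ≤ val a t′
  val-≤-simple a t = go t (ℕI.<-wellFounded t)
    where
    go : ∀ t → Acc ℕ._<_ t → ∃ λ t′ → Simple a t′ × val a t ≤ val a t′
    go t (acc rec) with simple⊎repeats a t
    ... | inj₁ simple = t , simple , ℚP.≤-refl
    ... | inj₂ (repeats i m r simple eq) =
      let t′ , simple′ , le = go (r ℕ.+ i) (rec (ℕP.+-monoʳ-< r (s≤s (ℕP.m≤n+m i m))))
      in  t′ , simple′ , ℚP.≤-trans (val-excise a i m r simple eq) le

  -- The maximal gain `U`.

  private
    best : K → ℕ → ℚ
    -- The candidate 0 makes `U` nonnegative, so restricting a sum of `U` to some of the nodes never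
    -- increases it.
    best a zero    = 0ℚ ⊔ val a zero
    best a (suc t) = best a t ⊔ val a (suc t)

    best-nonneg : ∀ a t → 0ℚ ≤ best a t
    best-nonneg a zero    = ℚP.p≤p⊔q 0ℚ (val a zero)
    best-nonneg a (suc t) = ℚP.≤-trans (best-nonneg a t) (ℚP.p≤p⊔q (best a t) (val a (suc t)))

    val≤best : ∀ a {t N} → t ℕ.≤ N → val a t ≤ best a N
    val≤best a {zero}  {zero}  _ = ℚP.p≤q⊔p 0ℚ (val a zero)
    val≤best a {t} {suc N} t≤ with ℕP.m≤n⇒m<n∨m≡n t≤
    ... | inj₁ (s≤s t≤N) = ℚP.≤-trans (val≤best a t≤N) (ℚP.p≤p⊔q (best a N) (val a (suc N)))
    ... | inj₂ refl      = ℚP.p≤q⊔p (best a N) (val a (suc N))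

    best-least : ∀ a N {B} → 0ℚ ≤ B → (∀ t → val a t ≤ B) → best a N ≤ B
    best-least a zero    0≤B le = ℚP.⊔-lub 0≤B (le zero)
    best-least a (suc N) 0≤B le = ℚP.⊔-lub (best-least a N 0≤B le) (le (suc N))

  -- The best total gain over all walks leaving a; walks of length at most k' suffice,
  -- since excising a cycle does not decrease the gain.
  U : K → ℚ
  U a = best a k'

  U-nonneg : ∀ a → 0ℚ ≤ U a
  U-nonneg a = best-nonneg a k'

  val≤U : ∀ a t → val a t ≤ U a
  val≤U a t = let t′ , simple , le = val-≤-simple a t in
    ℚP.≤-trans le (val≤best a (simple-bounded a t′ simple))

  U-least : ∀ a {B} → 0ℚ ≤ B → (∀ t → val a t ≤ B) → U a ≤ B
  U-least a = best-least a k'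

  -- Upper bounds on `U` need only the simple walks, which are the ones realised by swaps; `val≤U`
  -- gives lower bounds from arbitrary walks.
  U-least-simple : ∀ a {B} → 0ℚ ≤ B → (∀ t → Simple a t → val a t ≤ B) → U a ≤ B
  U-least-simple a 0≤B le = U-least a 0≤B λ t → let t′ , simple , le′ = val-≤-simple a t in
    ℚP.≤-trans le′ (le t′ simple)

  h≤U : ∀ a → h a ≤ U a
  h≤U a = ℚP.≤-trans (ℚP.≤-reflexive (sym (ℚP.+-identityˡ _))) (val≤U a 0)

  -- Slack, and the change of `U` along a link.

  m : K → ℚ
  m a = w a * moved* a

  -- The amount by which the triangle bound `gap≤` fails to be tight, without and with the weight.
  slackDistance slack : K → ℚ
  slackDistance a = moved a + moved* a - gap a
  slack a = w a * slackDistance a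

  m-nonneg : ∀ a → 0ℚ ≤ m a
  m-nonneg a = *-nonneg (weight-nonneg a) (nonneg _ _)

  s-o-distance : ∀ a → c (s a) (o a) ≤ moved a + moved* a
  s-o-distance a = ℚP.≤-trans (triangle (s a) (init a) (o a))
                              (ℚP.≤-reflexive (cong (_+ moved* a) (symmetric (s a) (init a))))

  gap≤ : ∀ a → gap a ≤ moved a + moved* a
  gap≤ a = ℚP.≤-trans (nearest-≤ s (o a) a)
    (ℚP.≤-trans (ℚP.≤-reflexive (symmetric (o a) (s a))) (s-o-distance a))

  slackDistance-nonneg : ∀ a → 0ℚ ≤ slackDistance a
  slackDistance-nonneg a = ≤-by (gap≤ a)
    (solve 2 (λ x g → con 0ℚ :+ x := x :- g :+ g) refl (moved a + moved* a) (gap a))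

  slack-nonneg : ∀ a → 0ℚ ≤ slack a
  slack-nonneg a = *-nonneg (weight-nonneg a) (slackDistance-nonneg a)

  -- Going through `o a`, the distance from `init a` to `s (η a)` is at most `moved* a + gap a`. As
  -- slack is nonnegative, one shift loses at most `m a + m a`.
  slack≤γ : ∀ a → slack a ≤ γ a + (m a + m a)
  slack≤γ a = ≤-by (*-monoʳ (weight-nonneg a) (triangle (init a) (o a) (s (η a))))
    (solve 5 (λ w m m* g x → w :* (m :+ m* :- g) :+ w :* (m* :+ g)
                := w :* (m :- x) :+ (w :* m* :+ w :* m*) :+ w :* x) refl
      (w a) (moved a) (moved* a) (gap a) (c (init a) (s (η a))))

  saving-nonneg : ∀ i → 0ℚ ≤ saving i + r i
  saving-nonneg i = ℚP.≤-trans (sum-nonneg pointwise)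
    (ℚP.≤-reflexive (sum-+ (λ j → when (τ j ≟ i) (d j * (Sdist j - Odist j))) (λ j → when (τ j ≟ i) (d j * Odist j))))
    where
    pointwise : ∀ j → 0ℚ ≤ when (τ j ≟ i) (d j * (Sdist j - Odist j)) + when (τ j ≟ i) (d j * Odist j)
    pointwise j = subst (0ℚ ≤_) (when-+ (τ j ≟ i)) (when-nonneg (τ j ≟ i) λ _ →
      ≤-by (*-nonneg (d-nonneg j) (nonneg j (s (σ j))))
        (solve 3 (λ d S O → con 0ℚ :+ d :* S := d :* (S :- O) :+ d :* O :+ con 0ℚ) refl (d j) (Sdist j) (Odist j)))

  opt : K → ℚ
  opt a = m a + r a

  opt-nonneg : ∀ a → 0ℚ ≤ opt a
  opt-nonneg a = +-nonneg (m-nonneg a) (r-nonneg a)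

  h-bounded-below : ∀ i → 0ℚ ≤ h i + opt i
  h-bounded-below i = ≤-by (*-nonneg (weight-nonneg i) (nonneg (init i) (s i)) ⊕ saving-nonneg i)
    (solve 5 (λ w m m* A r → con 0ℚ :+ (w :* m :+ (A :+ r))
       := w :* (m :- m*) :+ A :+ (w :* m* :+ r) :+ (con 0ℚ :+ con 0ℚ)) refl
      (w i) (moved i) (moved* i) (saving i) (r i))

  -- `walk` grows at its end; peeling off the first link instead is what relates `U (η a)` to `U a`.
  val-suc : ∀ a t → val a (suc t) ≡ γ a + val (η a) t
  val-suc a t = trans (cong₂ _+_ (gain-suc t) (cong h (sym (walk-suc t)))) (ℚP.+-assoc (γ a) _ _)
    where
    walk-suc : ∀ t → walk (η a) t ≡ η (walk a t)
    walk-suc zero    = refl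
    walk-suc (suc t) = cong η (walk-suc t)
    gain-suc : ∀ t → gain a (suc t) ≡ γ a + gain (η a) t
    gain-suc zero    = ℚP.+-comm 0ℚ (γ a)
    gain-suc (suc t) = trans (cong₂ _+_ (gain-suc t) (cong γ (sym (walk-suc t)))) (ℚP.+-assoc (γ a) _ _)

  γ+val≤U : ∀ a t → γ a + val (η a) t ≤ U a
  γ+val≤U a t = ℚP.≤-trans (ℚP.≤-reflexive (sym (val-suc a t))) (val≤U a (suc t))

  -- Prefixing the link from `a` turns a walk leaving `η a` into one leaving `a`, and the additional
  -- shift is cheap by `slack≤γ`.
  U-step : ∀ a → U (η a) ≤ U a + (m a + m a)
  U-step a = U-least (η a) (+-nonneg (U-nonneg a) (+-nonneg (m-nonneg a) (m-nonneg a)))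
    λ t → ≤-by (γ+val≤U a t ⊕ slack≤γ a ⊕ slack-nonneg a)
      (solve 5 (λ v u m g sl → v :+ (u :+ (g :+ m :+ sl)) := u :+ m :+ (g :+ v :+ (sl :+ con 0ℚ))) refl
        (val (η a) t) (U a) (m a + m a) (γ a) (slack a))

  -- The same prefixing with the slack kept. The term `opt (η a)` pays for the candidate 0 in
  -- `U (η a)`: the walk that stops at once has value `h (η a)`, which is at least minus
  -- `opt (η a)`.
  U-step-slack : ∀ a → U (η a) + slack a ≤ U a + (m a + m a) + opt (η a)
  U-step-slack a = ≤-by (U-least (η a) {U a + opt (η a) - γ a} nonneg′ le ⊕ slack≤γ a)
    (solve 6 (λ U′ sl u mm o g → U′ :+ sl :+ (u :+ o :- g :+ (g :+ mm)) := u :+ mm :+ o :+ (U′ :+ sl)) refl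
      (U (η a)) (slack a) (U a) (m a + m a) (opt (η a)) (γ a))
    where
    nonneg′ : 0ℚ ≤ U a + opt (η a) - γ a
    nonneg′ = ≤-by (γ+val≤U a 0 ⊕ h-bounded-below (η a))
      (solve 4 (λ u h o g → con 0ℚ :+ (u :+ (h :+ o)) := u :+ o :- g :+ (g :+ (con 0ℚ :+ h) :+ con 0ℚ)) refl
        (U a) (h (η a)) (opt (η a)) (γ a))
    le : ∀ t → val (η a) t ≤ U a + opt (η a) - γ a
    le t = ≤-by (γ+val≤U a t ⊕ opt-nonneg (η a))
      (solve 4 (λ v u o g → v :+ (u :+ o) := u :+ o :- g :+ (g :+ v :+ con 0ℚ)) refl
        (val (η a) t) (U a) (opt (η a)) (γ a))

  -- Bounds on `U` from the loss of closing one location.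

  Unique : K → Set
  Unique p = ∀ p′ → η p′ ≡ η p → p′ ≡ p

  loss-nonneg : ∀ a {X} → 0ℚ ≤ X → 0ℚ ≤ q a + q a + captured a * X
  loss-nonneg a 0≤X = +-nonneg (+-nonneg (q-nonneg a) (q-nonneg a)) (*-nonneg (captured-nonneg a) 0≤X)

  -- Nothing is captured, because no optimal location has `s a` as its nearest one; hence the
  -- fallback distance 0.
  U-leaf : ∀ a → (∀ p → η p ≢ a) → U a ≤ q a + q a
  U-leaf a leaf = ℚP.≤-trans
    (U-least-simple a (loss-nonneg a ℚP.≤-refl) λ t simple →
      val-simple a t simple 0ℚ ℚP.≤-refl (λ j _ _ eq → ⊥-elim (leaf (τ j) eq)))
    (ℚP.≤-reflexive (solve 2 (λ q c → q :+ q :+ c :* con 0ℚ := q :+ q) refl (q a) (captured a)))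

  -- The captured clients of η p can fall back on the location of p itself.
  U-fallback-pred : ∀ p → Unique p → U (η p) ≤ q (η p) + q (η p) + captured (η p) * slackDistance p
  U-fallback-pred p unique = U-least-simple (η p) (loss-nonneg (η p) (slackDistance-nonneg p)) λ t simple →
    val-simple (η p) t simple (slackDistance p) (slackDistance-nonneg p) (far t simple)
    where
    far : ∀ t → Simple (η p) t → ∀ j → σ j ≡ η p → τ j ≢ walk (η p) t → η (τ j) ≡ η p →
          ∃ λ l → c j (shiftAndOpen (η p) t l) ≤ Sdist j + (Odist j + Odist j + slackDistance p)
    far t simple j σj≡ τj≢ ητj≡ =
      let l , eq = shiftAndOpen-covers (η p) t simple p (p≢ηp t simple τj≢)
      in  l , ℚP.≤-trans (ℚP.≤-reflexive (cong (c j) eq)) close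
      where
      τj≡p : τ j ≡ p
      τj≡p = unique (τ j) ητj≡
      -- The fallback `s p` must not be the closed location. If `p ≡ η p`, the walk of length 0
      -- already opens `o p`, the location of `j`, and a longer simple walk cannot use the loop.
      p≢ηp : ∀ t → Simple (η p) t → τ j ≢ walk (η p) t → p ≢ η p
      p≢ηp zero    _ τj≢ e = τj≢ (trans τj≡p e)
      p≢ηp (suc t) simple _ e =
        simple-distinct (η p) (suc t) simple {0} {1} (s≤s z≤n) (s≤s z≤n) (cong η e)
      close : c j (s p) ≤ Sdist j + (Odist j + Odist j + slackDistance p)
      close = subst (λ x → c j (s p) ≤ Sdist j + (c j (o x) + c j (o x) + slackDistance p)) (sym τj≡p)
        (≤-by (triangle j (o p) (s p)
               ⊕ ℚP.≤-trans (ℚP.≤-reflexive (symmetric (o p) (s p))) (s-o-distance p)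
               ⊕ triangle (o p) j (s (η p))
               ⊕ ℚP.≤-reflexive (cong₂ _+_ (symmetric (o p) j) (cong (λ l → c j (s l)) (sym σj≡))))
          (solve 8 (λ x O os mm oj js g S →
              x :+ (O :+ os :+ (mm :+ (oj :+ js :+ (O :+ S))))
                := S :+ (O :+ O :+ (mm :- g)) :+ (x :+ (os :+ (g :+ (oj :+ js))))) refl
            (c j (s p)) (c j (o p)) (c (o p) (s p)) (moved p + moved* p) (c (o p) j)
            (c j (s (η p))) (gap p) (Sdist j)))

  -- The clients of a can also follow a to its optimal location and on to the location nearest to that.
  U-fallback-succ : ∀ a → U a ≤ q a + q a + captured a * (moved a + moved* a + (moved a + moved* a))
  U-fallback-succ a = U-least-simple a (loss-nonneg a 0≤X) λ t simple →
    val-simple a t simple X 0≤X (far t simple)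
    where
    D = moved a + moved* a
    X = D + D
    0≤D : 0ℚ ≤ D
    0≤D = +-nonneg (nonneg _ _) (nonneg _ _)
    0≤X = +-nonneg 0≤D 0≤D
    far : ∀ t → Simple a t → ∀ j → σ j ≡ a → τ j ≢ walk a t → η (τ j) ≡ a →
          ∃ λ l → c j (shiftAndOpen a t l) ≤ Sdist j + (Odist j + Odist j + X)
    -- For length 0 the node `η a` may be `a` itself, but then `o a` is opened, within `D` of `s a`.
    -- For longer simple walks `η a` differs from `a`, and `s (η a)` stays open within `D + D`.
    far zero _ j refl _ _ = a , ℚP.≤-trans (ℚP.≤-reflexive (cong (c j) (shiftAndOpen-opens a 0)))
      (≤-by (triangle j (s a) (o a) ⊕ s-o-distance a ⊕ 0≤D ⊕ Odist-nonneg j ⊕ Odist-nonneg j)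
        (solve 5 (λ x S so D O → x :+ (S :+ so :+ (D :+ (D :+ (O :+ O))))
                    := S :+ (O :+ O :+ (D :+ D)) :+ (x :+ (so :+ (con 0ℚ :+ (con 0ℚ :+ con 0ℚ))))) refl
          (c j (o a)) (Sdist j) (c (s a) (o a)) D (Odist j)))
    far (suc t) simple j refl _ _ =
      let l , eq = shiftAndOpen-covers a (suc t) simple (η a)
                     (λ e → simple-distinct a (suc t) simple {0} {1} (s≤s z≤n) (s≤s z≤n) (sym e))
      in  l , ℚP.≤-trans (ℚP.≤-reflexive (cong (c j) eq))
        (≤-by (triangle j (s a) (s (η a)) ⊕ triangle (s a) (o a) (s (η a)) ⊕ s-o-distance a ⊕ gap≤ a
               ⊕ Odist-nonneg j ⊕ Odist-nonneg j)
          (solve 7 (λ x S ss so D O g → x :+ (S :+ ss :+ (so :+ g :+ (D :+ (D :+ (O :+ O)))))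
                      := S :+ (O :+ O :+ (D :+ D)) :+ (x :+ (ss :+ (so :+ (g :+ (con 0ℚ :+ con 0ℚ)))))) refl
            (c j (s (η a))) (Sdist j) (c (s a) (s (η a))) (c (s a) (o a)) D (Odist j) (gap a)))

  -- By uniqueness each captured client `j` of `η p` has `τ j ≡ p`, so `gap p` is at most
  -- `Sdist j + Odist j`, which is `Sdist j - Odist j` plus twice `Odist j`.
  captured-gap≤saving : ∀ p → Unique p → captured (η p) * gap p ≤ saving p + (r p + r p)
  captured-gap≤saving p unique = begin
    captured (η p) * gap p
      ≡⟨ sym (sum-*ʳ cap (gap p)) ⟩
    sumℚ (λ j → cap j * gap p)
      ≤⟨ sum-mono pointwise ⟩
    sumℚ (λ j → sv j + (rp j + rp j))
      ≡⟨ trans (sum-+ sv (λ j → rp j + rp j)) (cong (saving p +_) (sum-+ rp rp)) ⟩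
    saving p + (r p + r p) ∎
    where
    open ≤-Reasoning
    cap sv rp : Fin n → ℚ
    cap j = when (σ j ≟ η p) (when (η (τ j) ≟ η p) (d j))
    sv j  = when (τ j ≟ p) (d j * (Sdist j - Odist j))
    rp j  = when (τ j ≟ p) (d j * Odist j)
    identity : ∀ d S O → d * (S + O) ≡ d * (S - O) + (d * O + d * O)
    identity = solve 3 (λ d S O → d :* (S :+ O) := d :* (S :- O) :+ (d :* O :+ d :* O)) refl
    rhs : ∀ j → when (τ j ≟ p) (d j * (Sdist j + Odist j)) ≡ sv j + (rp j + rp j)
    rhs j = trans (cong (when (τ j ≟ p)) (identity (d j) (Sdist j) (Odist j)))
              (trans (when-+ (τ j ≟ p)) (cong (sv j +_) (when-+ (τ j ≟ p))))
    nonneg-dSO : ∀ j → 0ℚ ≤ d j * (Sdist j + Odist j)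
    nonneg-dSO j = *-nonneg (d-nonneg j) (+-nonneg (nonneg j (s (σ j))) (Odist-nonneg j))
    gap≤SO : ∀ j → σ j ≡ η p → τ j ≡ p → gap p ≤ Sdist j + Odist j
    gap≤SO j σj≡ refl = ℚP.≤-trans (triangle (o (τ j)) j (s (η (τ j))))
      (ℚP.≤-reflexive (trans (cong₂ _+_ (symmetric (o (τ j)) j) (cong (λ l → c j (s l)) (sym σj≡)))
                             (ℚP.+-comm (Odist j) (Sdist j))))
    lhs : ∀ j (σ? : Dec (σ j ≡ η p)) (η? : Dec (η (τ j) ≡ η p)) →
          when σ? (when η? (d j)) * gap p ≤ when (τ j ≟ p) (d j * (Sdist j + Odist j))
    lhs j (yes σj≡) (yes ητj≡) = ℚP.≤-trans (*-monoʳ (d-nonneg j) (gap≤SO j σj≡ (unique (τ j) ητj≡)))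
      (ℚP.≤-reflexive (sym (when-yes (τ j ≟ p) (unique (τ j) ητj≡))))
    lhs j (yes _) (no _) = ℚP.≤-trans (ℚP.≤-reflexive (ℚP.*-zeroˡ (gap p))) (when-nonneg (τ j ≟ p) (λ _ → nonneg-dSO j))
    lhs j (no _) _       = ℚP.≤-trans (ℚP.≤-reflexive (ℚP.*-zeroˡ (gap p))) (when-nonneg (τ j ≟ p) (λ _ → nonneg-dSO j))
    pointwise : ∀ j → cap j * gap p ≤ sv j + (rp j + rp j)
    pointwise j = ℚP.≤-trans (lhs j (σ j ≟ η p) (η (τ j) ≟ η p)) (ℚP.≤-reflexive (rhs j))

  -- The facility η p moves straight to o p.
  saving≤gap : ∀ p → Unique p → saving p ≤ w (η p) * gap p + (q (η p) + q (η p))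
  saving≤gap p unique = ≤-by
    (exchange (s [ a ↦ o p ]) a p 0ℚ ℚP.≤-refl
        (λ u u≢a → u , update-other s a (o p) u≢a)
        (a , update-same s a (o p))
        -- By uniqueness every captured client belongs to `o p`, which is being opened, so none
        -- needs a fallback.
        (λ j _ τj≢p ητj≡ → ⊥-elim (τj≢p (unique (τ j) ητj≡)))
      ⊕ ℚP.≤-reflexive (movementCost-update s a (o p))
      ⊕ *-monoʳ (weight-nonneg a) (triangle (init a) (s a) (o p))
      ⊕ ℚP.≤-reflexive (cong (w a *_) (symmetric (s a) (o p))))
    (solve 10 (λ A w g q cap M M′ mv x so →
        A :+ ((q :+ q :+ cap :* con 0ℚ) :+ (M :+ w :* x :+ (w :* (mv :+ so) :+ w :* g)))
          := w :* g :+ (q :+ q) :+ (M :- M′ :+ A :+ (M′ :+ w :* mv :+ (w :* x :+ w :* so)))) refl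
      (saving p) (w a) (gap p) (q a) (captured a) (movementCost I s) (movementCost I (s [ a ↦ o p ]))
      (moved a) (c (init a) (o p)) (c (s a) (o p)))
    where
    a = η p

  -- Sums over nodes and links, and nodes of in-degree other than one.

  M Q C : ℚ
  M = movementCost I o
  Q = assignmentCost I o
  C = M + Q

  sum-q : sumℚ q ≡ Q
  sum-q = trans (sum-fibres σ (λ j → d j * Odist j)) (sym assignmentCost-o)

  sum-r : sumℚ r ≡ Q
  sum-r = trans (sum-fibres τ (λ j → d j * Odist j)) (sym assignmentCost-o)

  M-nonneg : 0ℚ ≤ M
  M-nonneg = sum-nonneg m-nonneg

  Q-nonneg : 0ℚ ≤ Q
  Q-nonneg = subst (0ℚ ≤_) sum-q (sum-nonneg q-nonneg)

  -- The gross gains add up to the difference of the two costs, so it remains to bound `sumℚ h` by a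
  -- multiple of `C`.
  solutionCost-s : solutionCost I s ≡ sumℚ h + C
  solutionCost-s = sym (begin
    sumℚ h + (M + Q)
      ≡⟨ cong₂ (λ x y → x + (M + y)) (sum-+ hm saving) (sym sum-r) ⟩
    sumℚ hm + sumℚ saving + (sumℚ m + sumℚ r)
      ≡⟨ solve 4 (λ a b c d → a :+ b :+ (c :+ d) := a :+ c :+ (b :+ d)) refl (sumℚ hm) (sumℚ saving) (sumℚ m) (sumℚ r) ⟩
    sumℚ hm + sumℚ m + (sumℚ saving + sumℚ r)
      ≡⟨ cong₂ _+_ (sym (sum-+ hm m)) (cong₂ _+_ (sum-fibres τ sv) (sum-fibres τ rv)) ⟩
    sumℚ (λ i → hm i + m i) + (sumℚ sv + sumℚ rv)
      ≡⟨ cong₂ _+_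
           (sum-cong (λ i → solve 3 (λ w x y → w :* (x :- y) :+ w :* y := w :* x) refl (w i) (moved i) (moved* i)))
           (trans (sym (sum-+ sv rv))
             (sum-cong (λ j → solve 3 (λ d S O → d :* (S :- O) :+ d :* O := d :* S) refl (d j) (Sdist j) (Odist j)))) ⟩
    movementCost I s + sumℚ (λ j → d j * Sdist j)
      ≡⟨ cong (movementCost I s +_) (sym assignmentCost-s) ⟩
    solutionCost I s ∎)
    where
    open ≡-Reasoning
    hm : K → ℚ
    hm i = w i * (moved i - moved* i)
    sv rv : Fin n → ℚ
    sv j = d j * (Sdist j - Odist j)
    rv j = d j * Odist j

  unique? : ∀ p → Dec (Unique p)
  unique? p = all? λ p′ → (η p′ ≟ η p) →-dec (p′ ≟ p)

  Single : K → Set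
  Single v = ∃ λ p → η p ≡ v × Unique p

  single? : ∀ v → Dec (Single v)
  single? v = any? λ p → (η p ≟ v) ×-dec unique? p

  data Fibre (v : K) : Set where
    none : (∀ p → η p ≢ v) → Fibre v
    one  : Single v → Fibre v
    many : ∀ p p′ → p ≢ p′ → η p ≡ v → η p′ ≡ v → Fibre v

  fibre : ∀ v → Fibre v
  fibre v with any? (λ p → η p ≟ v)
  ... | no ¬p = none (λ p e → ¬p (p , e))
  ... | yes (p , refl) with any? (λ p′ → (η p′ ≟ η p) ×-dec (¬? (p′ ≟ p)))
  ...   | yes (p′ , e , p′≢p) = many p p′ (λ e′ → p′≢p (sym e′)) refl e
  ...   | no ¬p′ = one (p , refl , λ p′ e → decidable-stable (p′ ≟ p) (λ p′≢p → ¬p′ (p′ , e , p′≢p)))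

  -- `η` maps the unique links bijectively to the nodes of in-degree one.
  sum-single : ∀ (F : K → ℚ) → sumℚ (λ p → when (unique? p) (F (η p))) ≡ sumℚ (λ v → when (single? v) (F v))
  sum-single F = begin
    sumℚ (λ p → when (unique? p) (F (η p)))
      ≡⟨ sym (sum-fibres η (λ p → when (unique? p) (F (η p)))) ⟩
    sumℚ (λ v → sumℚ (λ p → when (η p ≟ v) (when (unique? p) (F (η p)))))
      ≡⟨ sum-cong (λ v → inner v (single? v)) ⟩
    sumℚ (λ v → when (single? v) (F v)) ∎
    where
    open ≡-Reasoning
    inner : ∀ v (sing : Dec (Single v)) →
            sumℚ (λ p → when (η p ≟ v) (when (unique? p) (F (η p)))) ≡ when sing (F v)
    inner v (no ¬sing) = sum-zero (λ p → when (η p ≟ v) (when (unique? p) (F (η p)))) λ p → vanish p (η p ≟ v) (unique? p)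
      where
      vanish : ∀ p (e : Dec (η p ≡ v)) (u : Dec (Unique p)) → when e (when u (F (η p))) ≡ 0ℚ
      vanish p (yes e) (yes u) = ⊥-elim (¬sing (p , e , u))
      vanish p (yes _) (no _)  = refl
      vanish p (no _)  _       = refl
    inner v (yes (p₀ , refl , u₀)) = trans (sum-cong (λ p → same p (p ≟ p₀)))
                                           (sum-when (λ _ → F v) p₀)
      where
      same : ∀ p (e : Dec (p ≡ p₀)) → when (η p ≟ v) (when (unique? p) (F (η p))) ≡ when e (F v)
      same p (yes refl) = trans (when-yes (η p ≟ v) refl) (when-yes (unique? p) u₀)
      same p (no p≢p₀)  = when-no (η p ≟ v) (λ e → p≢p₀ (u₀ p e))

  sum-split : ∀ (F : K → ℚ) → sumℚ F ≡ sumℚ (λ v → when (¬? (single? v)) (F v))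
                                      + sumℚ (λ p → when (unique? p) (F (η p)))
  sum-split F = sym (trans (cong (sumℚ (λ v → when (¬? (single? v)) (F v)) +_) (sum-single F))
    (trans (sym (sum-+ (λ v → when (¬? (single? v)) (F v)) (λ v → when (single? v) (F v))))
           (sum-cong (λ v → merge v (single? v)))))
    where
    merge : ∀ v (e : Dec (Single v)) → when (¬? e) (F v) + when e (F v) ≡ F v
    merge v (yes _) = ℚP.+-identityˡ _
    merge v (no _)  = ℚP.+-identityʳ _

  sum-pull : ∀ (F : K → ℚ) → (∀ v → 0ℚ ≤ F v) → sumℚ (λ p → when (unique? p) (F (η p))) ≤ sumℚ F
  sum-pull F 0≤F = ℚP.≤-trans (ℚP.≤-reflexive (sum-single F))
    (sum-mono (λ v → when-≤ (single? v) (0≤F v) (λ _ → ℚP.≤-refl)))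

  nonsingle : ℚ
  nonsingle = sumℚ (λ v → when (¬? (single? v)) (U v))

  -- At each node, `U v`, doubled unless the in-degree is one, is at most in-degree times `U v` plus
  -- `4 q v`: leaves use `U-leaf`, shared nodes have two incoming terms. Summing and applying
  -- `U-step` cancels one full sum of `U` and leaves `2 M + 4 Q`.
  nonsingle-bound : nonsingle ≤ ℕtoℚ 4 * C
  nonsingle-bound = ≤-by
    (subst₂ _≤_ (sum-+ U (λ v → when (¬? (single? v)) (U v)))
        (trans (sum-+ (λ v → sumℚ (λ p → when (η p ≟ v) (U (η p)))) (λ v → q v + q v + (q v + q v)))
          (cong₂ _+_ (sum-fibres η (λ p → U (η p)))
            (trans (sum-+ (λ v → q v + q v) (λ v → q v + q v))
              (cong (λ x → x + x) (trans (sum-+ q q) (cong (λ x → x + x) sum-q))))))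
        (sum-mono (λ v → pointwise v (fibre v)))
      ⊕ subst (sumℚ (λ p → U (η p)) ≤_)
          (trans (sum-+ U (λ p → m p + m p)) (cong (sumℚ U +_) (sum-+ m m)))
          (sum-mono U-step)
      ⊕ M-nonneg ⊕ M-nonneg)
    (solve 5 (λ NS U Uη M Q → NS :+ ((Uη :+ ((Q :+ Q) :+ (Q :+ Q))) :+ ((U :+ (M :+ M)) :+ (M :+ M)))
        := con (ℕtoℚ 4) :* (M :+ Q) :+ (U :+ NS :+ (Uη :+ (con 0ℚ :+ con 0ℚ)))) refl
      nonsingle (sumℚ U) (sumℚ (λ p → U (η p))) M Q)
    where
    degree-nonneg : ∀ v p → 0ℚ ≤ when (η p ≟ v) (U (η p))
    degree-nonneg v p = when-nonneg (η p ≟ v) (λ _ → U-nonneg (η p))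
    4q-nonneg : ∀ v → 0ℚ ≤ q v + q v + (q v + q v)
    4q-nonneg v = +-nonneg (+-nonneg (q-nonneg v) (q-nonneg v)) (+-nonneg (q-nonneg v) (q-nonneg v))
    pointwise : ∀ v → Fibre v → U v + when (¬? (single? v)) (U v)
                ≤ sumℚ (λ p → when (η p ≟ v) (U (η p))) + (q v + q v + (q v + q v))
    pointwise v (none leaf) = ℚP.≤-trans
      (U-leaf v leaf ⊕ ℚP.≤-trans (when-≤ (¬? (single? v)) (U-nonneg v) (λ _ → ℚP.≤-refl)) (U-leaf v leaf))
      (ℚP.≤-trans (ℚP.≤-reflexive (sym (ℚP.+-identityˡ _)))
        (sum-nonneg (degree-nonneg v) ⊕ ℚP.≤-refl))
    pointwise v (one sing@(p , refl , _)) =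
      ℚP.≤-trans (ℚP.≤-reflexive (sym (when-yes (η p ≟ η p) refl))) (term≤sum (degree-nonneg v) p)
      ⊕ ℚP.≤-trans (ℚP.≤-reflexive (when-no (¬? (single? v)) (λ ¬s → ¬s sing))) (4q-nonneg v)
    pointwise v (many p p′ p≢p′ refl e) = begin
      U v + when (¬? (single? v)) (U v)
        ≤⟨ ℚP.+-monoʳ-≤ (U v) (when-≤ (¬? (single? v)) (U-nonneg v) (λ _ → ℚP.≤-refl)) ⟩
      U v + U v
        ≡⟨ sym (cong₂ _+_ (when-yes (η p ≟ v) refl) (trans (when-yes (η p′ ≟ v) e) (cong U e))) ⟩
      when (η p ≟ v) (U (η p)) + when (η p′ ≟ v) (U (η p′))
        ≤⟨ terms≤sum (degree-nonneg v) p≢p′ ⟩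
      sumℚ (λ p → when (η p ≟ v) (U (η p)))
        ≡⟨ sym (ℚP.+-identityʳ _) ⟩
      sumℚ (λ p → when (η p ≟ v) (U (η p))) + 0ℚ
        ≤⟨ ℚP.+-monoʳ-≤ (sumℚ (λ p → when (η p ≟ v) (U (η p)))) (4q-nonneg v) ⟩
      sumℚ (λ p → when (η p ≟ v) (U (η p))) + (q v + q v + (q v + q v)) ∎
      where open ≤-Reasoning

  totalSlack : ℚ
  totalSlack = sumℚ (λ p → when (unique? p) (slack p))

  -- Summing `U-step-slack` over the unique links, the terms `U (η p)` cancel against the sum of `U`
  -- except for `nonsingle`. What remains is `nonsingle + 2 M + (M + Q)`.
  totalSlack-bound : totalSlack ≤ ℕtoℚ 7 * C
  totalSlack-bound = ≤-by
    (subst₂ _≤_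
        (trans (sum-cong (λ p → when-+ {x = U (η p)} {slack p} (unique? p)))
          (sum-+ (λ p → when (unique? p) (U (η p))) (λ p → when (unique? p) (slack p))))
        (trans (sum-+ (λ p → U p + (m p + m p)) (λ p → when (unique? p) (opt (η p))))
          (cong (_+ sumℚ (λ p → when (unique? p) (opt (η p))))
            (trans (sum-+ U (λ p → m p + m p)) (cong (sumℚ U +_) (sum-+ m m)))))
        (sum-mono (λ p → pointwise p (unique? p)))
      ⊕ ℚP.≤-reflexive (sum-split U)
      ⊕ subst (sumℚ (λ p → when (unique? p) (opt (η p))) ≤_) (trans (sum-+ m r) (cong (M +_) sum-r))
          (sum-pull opt opt-nonneg)
      ⊕ nonsingle-bound ⊕ Q-nonneg ⊕ Q-nonneg)
    (solve 7 (λ SL U Uη NS O M Q →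
        SL :+ (U :+ (M :+ M) :+ O :+ (NS :+ Uη :+ ((M :+ Q) :+ (con (ℕtoℚ 4) :* (M :+ Q) :+ (Q :+ Q)))))
          := con (ℕtoℚ 7) :* (M :+ Q) :+ (Uη :+ SL :+ (U :+ (O :+ (NS :+ (con 0ℚ :+ con 0ℚ)))))) refl
      totalSlack (sumℚ U) (sumℚ (λ p → when (unique? p) (U (η p)))) nonsingle
      (sumℚ (λ p → when (unique? p) (opt (η p)))) M Q)
    where
    pointwise : ∀ p (u : Dec (Unique p)) →
                when u (U (η p) + slack p) ≤ U p + (m p + m p) + when u (opt (η p))
    pointwise p (yes _) = U-step-slack p
    pointwise p (no _)  = +-nonneg (+-nonneg (U-nonneg p) (+-nonneg (m-nonneg p) (m-nonneg p))) ℚP.≤-refl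

  -- Classification of links.

  data Link : Set where
    shared light medium heavy : Link

  -- The classes overlap at equality; `kind` makes a choice, so that each link has one class.
  data Kind (p : K) : Link → Set where
    is-shared : ¬ Unique p → Kind p shared
    is-light  : Unique p → captured (η p) ≤ ℕtoℚ 8 * w p → Kind p light
    is-medium : Unique p → ℕtoℚ 8 * w p ≤ captured (η p) →
                captured (η p) ≤ ℕtoℚ 2 * w (η p) → Kind p medium
    is-heavy  : Unique p → ℕtoℚ 8 * w p ≤ captured (η p) →
                ℕtoℚ 2 * w (η p) ≤ captured (η p) → Kind p heavy

  kind : ∀ p → ∃ (Kind p)
  kind p = classify (unique? p) (ℚP.≤-total (captured (η p)) (ℕtoℚ 8 * w p))
                    (ℚP.≤-total (captured (η p)) (ℕtoℚ 2 * w (η p)))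
    where
    classify : Dec (Unique p) →
               captured (η p) ≤ ℕtoℚ 8 * w p ⊎ ℕtoℚ 8 * w p ≤ captured (η p) →
               captured (η p) ≤ ℕtoℚ 2 * w (η p) ⊎ ℕtoℚ 2 * w (η p) ≤ captured (η p) → ∃ (Kind p)
    classify (no ¬u) _         _         = shared , is-shared ¬u
    classify (yes u) (inj₁ le) _         = light  , is-light u le
    classify (yes u) (inj₂ ge) (inj₁ le) = medium , is-medium u ge le
    classify (yes u) (inj₂ ge) (inj₂ ge′) = heavy , is-heavy u ge ge′

  link : K → Link
  link p = proj₁ (kind p)

  on : (Link → Bool) → Link → ℚ → ℚ
  on χ κ x = if χ κ then x else 0ℚ

  -- Dominating links are those where the captured demand outweighs the facility: `8 w p` is at most
  -- `captured (η p)`.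
  isLight isMedium isHeavy isDominating isNotHeavy : Link → Bool
  isLight light = true
  isLight _     = false
  isMedium medium = true
  isMedium _      = false
  isHeavy heavy = true
  isHeavy _     = false
  isDominating medium = true
  isDominating heavy  = true
  isDominating _      = false
  isNotHeavy κ = not (isHeavy κ)

  on-≤ : ∀ χ κ {x} → 0ℚ ≤ x → on χ κ x ≤ x
  on-≤ χ κ 0≤x with χ κ
  ... | true  = ℚP.≤-refl
  ... | false = 0≤x

  w-gap-nonneg : ∀ a → 0ℚ ≤ w a * gap a
  w-gap-nonneg a = *-nonneg (weight-nonneg a) (nonneg _ _)

  -- Doubling `U-fallback-succ` gives `2 U v ≤ 4 q v + 8 w v D`, and `8 w v D` is `8 slack v` plus
  -- `8 w v * gap v`. The last term is at most `captured (η v) * gap v`, hence at most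
  -- `saving v + 2 r v`, and `saving v ≤ U v + m v`. One copy of `U v` cancels.
  dominating-node : ∀ v → Unique v → ℕtoℚ 8 * w v ≤ captured (η v) → captured v ≤ ℕtoℚ 2 * w v →
                    U v ≤ ℕtoℚ 4 * q v + ℕtoℚ 8 * slack v + opt v + r v
  dominating-node v u ge le = ≤-by
    (U-fallback-succ v ⊕ U-fallback-succ v ⊕ scaled ⊕ scaled
      ⊕ ℚP.*-monoʳ-≤-nonNeg (gap v) {{nonNegative (nonneg (o v) (s (η v)))}} ge
      ⊕ captured-gap≤saving v u ⊕ h≤U v
      ⊕ *-nonneg (weight-nonneg v) (nonneg (init v) (s v)))
    (solve 10 (λ U q cap mv mv* w g A r capη →
        let D = mv :+ mv* :+ (mv :+ mv*) in
        U :+ ((q :+ q :+ cap :* D) :+ ((q :+ q :+ cap :* D)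
          :+ (con (ℕtoℚ 2) :* w :* D :+ (con (ℕtoℚ 2) :* w :* D
          :+ (capη :* g :+ (A :+ (r :+ r) :+ (U :+ w :* mv)))))))
        := con (ℕtoℚ 4) :* q :+ con (ℕtoℚ 8) :* (w :* (mv :+ mv* :- g)) :+ (w :* mv* :+ r) :+ r
          :+ (U :+ (U :+ (cap :* D :+ (cap :* D
          :+ (con (ℕtoℚ 8) :* w :* g :+ (capη :* g :+ (w :* (mv :- mv*) :+ A :+ con 0ℚ))))))))
      refl (U v) (q v) (captured v) (moved v) (moved* v) (w v) (gap v) (saving v) (r v) (captured (η v)))
    where
    D = moved v + moved* v
    0≤D : 0ℚ ≤ D
    0≤D = +-nonneg (nonneg _ _) (nonneg _ _)
    scaled : captured v * (D + D) ≤ ℕtoℚ 2 * w v * (D + D)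
    scaled = ℚP.*-monoʳ-≤-nonNeg (D + D) {{nonNegative (+-nonneg 0≤D 0≤D)}} le

  -- The two bounds relating `gap v` and `saving v`, with `2 w (η v) ≤ captured (η v)`, absorb one
  -- copy of `w (η v) * gap v` and bound it by `2 q (η v) + 2 r v`. Then `saving v` is small, and so
  -- is `w v * gap v`.
  heavy-node : ∀ v → Kind v heavy → h v ≤ slack v + (ℕtoℚ 8 * q (η v) + ℕtoℚ 6 * r v)
  heavy-node v (is-heavy u ge ge′) = ≤-by
    (saving≤gap v u ⊕ W-gap ⊕ *-nonneg (ℕtoℚ-nonneg 7) (w-gap-nonneg v) ⊕ scale ge
      ⊕ captured-gap≤saving v u ⊕ saving≤gap v u ⊕ W-gap ⊕ m-nonneg v ⊕ m-nonneg v)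
    (solve 9 (λ mv mv* w g A r W q D →
        w :* (mv :- mv*) :+ A :+ (W :* g :+ (q :+ q) :+ (q :+ q :+ (r :+ r) :+ (con (ℕtoℚ 7) :* (w :* g)
          :+ (D :* g :+ (A :+ (r :+ r) :+ (W :* g :+ (q :+ q) :+ (q :+ q :+ (r :+ r) :+ (w :* mv* :+ w :* mv*))))))))
        := w :* (mv :+ mv* :- g) :+ (con (ℕtoℚ 8) :* q :+ con (ℕtoℚ 6) :* r)
          :+ (A :+ (W :* g :+ (con 0ℚ :+ (con (ℕtoℚ 8) :* w :* g :+ (D :* g :+ (A :+ (W :* g
          :+ (con 0ℚ :+ con 0ℚ)))))))))
      refl (moved v) (moved* v) (w v) (gap v) (saving v) (r v) (w (η v)) (q (η v)) (captured (η v)))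
    where
    scale : ∀ {x y} → x ≤ y → x * gap v ≤ y * gap v
    scale = ℚP.*-monoʳ-≤-nonNeg (gap v) {{nonNegative (nonneg (o v) (s (η v)))}}
    W-gap : w (η v) * gap v ≤ q (η v) + q (η v) + (r v + r v)
    W-gap = ≤-by (scale ge′ ⊕ captured-gap≤saving v u ⊕ saving≤gap v u)
      (solve 6 (λ W g D A r q →
          W :* g :+ (D :* g :+ (A :+ (r :+ r) :+ (W :* g :+ (q :+ q))))
          := q :+ q :+ (r :+ r) :+ (con (ℕtoℚ 2) :* W :* g :+ (D :* g :+ A))) refl
        (w (η v)) (gap v) (captured (η v)) (saving v) (r v) (q (η v)))

  -- Total gain over each class of links.

  atLight atMediumDominating atHeavyEnd atMedium : K → ℚ
  atLight p            = on isLight (link p) (U (η p))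
  atMediumDominating p = on isMedium (link p) (on isDominating (link (η p)) (U (η p)))
  atHeavyEnd p         = on isHeavy (link p) (on isNotHeavy (link (η p)) (U (η p)))
  atMedium p           = on isMedium (link p) (U (η p))

  linkSlack : K → ℚ
  linkSlack p = when (unique? p) (slack p)

  linkSlack-nonneg : ∀ p → 0ℚ ≤ linkSlack p
  linkSlack-nonneg p = when-nonneg (unique? p) (λ _ → slack-nonneg p)

  -- For a light link the loss in `U-fallback-pred` is at most `8 slack p` besides the `q` terms,
  -- giving `2 Q` plus 8 times `totalSlack`.
  light-bound : sumℚ atLight ≤ ℕtoℚ 58 * C
  light-bound = ≤-by
    (subst (sumℚ atLight ≤_)
        (trans (sum-+ (λ p → when (unique? p) (q (η p) + q (η p))) (λ p → ℕtoℚ 8 * linkSlack p))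
          (cong (sumℚ (λ p → when (unique? p) (q (η p) + q (η p))) +_) (sum-*ˡ (ℕtoℚ 8) linkSlack)))
        (sum-mono (λ p → pointwise p (proj₂ (kind p))))
      ⊕ subst (sumℚ (λ p → when (unique? p) (q (η p) + q (η p))) ≤_) (trans (sum-+ q q) (cong₂ _+_ sum-q sum-q))
          (sum-pull (λ v → q v + q v) (λ v → +-nonneg (q-nonneg v) (q-nonneg v)))
      ⊕ *-monoʳ (ℕtoℚ-nonneg 8) totalSlack-bound ⊕ M-nonneg ⊕ M-nonneg)
    (solve 5 (λ L X SL M Q →
        L :+ (X :+ con (ℕtoℚ 8) :* SL :+ (Q :+ Q :+ (con (ℕtoℚ 8) :* (con (ℕtoℚ 7) :* (M :+ Q)) :+ (M :+ M))))
        := con (ℕtoℚ 58) :* (M :+ Q) :+ (L :+ (X :+ (con (ℕtoℚ 8) :* SL :+ (con 0ℚ :+ con 0ℚ))))) refl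
      (sumℚ atLight) (sumℚ (λ p → when (unique? p) (q (η p) + q (η p)))) totalSlack M Q)
    where
    rhs : K → ℚ
    rhs p = when (unique? p) (q (η p) + q (η p)) + ℕtoℚ 8 * linkSlack p
    rhs-nonneg : ∀ p → 0ℚ ≤ rhs p
    rhs-nonneg p = +-nonneg (when-nonneg (unique? p) (λ _ → +-nonneg (q-nonneg (η p)) (q-nonneg (η p))))
                            (*-nonneg (ℕtoℚ-nonneg 8) (linkSlack-nonneg p))
    pointwise : ∀ p {κ} → Kind p κ → on isLight κ (U (η p)) ≤ rhs p
    pointwise p (is-shared _)     = rhs-nonneg p
    pointwise p (is-medium _ _ _) = rhs-nonneg p
    pointwise p (is-heavy _ _ _)  = rhs-nonneg p
    pointwise p (is-light u le)   = subst (U (η p) ≤_)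
      (cong₂ (λ x y → x + ℕtoℚ 8 * y) (sym (when-yes (unique? p) u)) (sym (when-yes (unique? p) u)))
      (≤-by (U-fallback-pred p u
             ⊕ ℚP.*-monoʳ-≤-nonNeg (slackDistance p) {{nonNegative (slackDistance-nonneg p)}} le)
        (solve 5 (λ U q cap sd w → U :+ (q :+ q :+ cap :* sd :+ con (ℕtoℚ 8) :* w :* sd)
            := q :+ q :+ con (ℕtoℚ 8) :* (w :* sd) :+ (U :+ cap :* sd)) refl
          (U (η p)) (q (η p)) (captured (η p)) (slackDistance p) (w p)))

  -- The two hypotheses of `dominating-node` at `η p` come from different links: the upper bound on
  -- `captured (η p)` from the medium link into it, the lower bound on `captured (η (η p))` from the
  -- dominating link out of it.
  mediumDominating-bound : sumℚ atMediumDominating ≤ ℕtoℚ 62 * C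
  mediumDominating-bound = ≤-by
    (sum-mono (λ p → pointwise p (proj₂ (kind p)) (proj₂ (kind (η p))))
      ⊕ subst (sumℚ (λ p → when (unique? p) (G (η p))) ≤_) sum-G (sum-pull G G-nonneg)
      ⊕ *-monoʳ (ℕtoℚ-nonneg 8) totalSlack-bound
      ⊕ *-nonneg (ℕtoℚ-nonneg 5) M-nonneg)
    (solve 5 (λ L X SL M Q →
        L :+ (X :+ (con (ℕtoℚ 4) :* Q :+ con (ℕtoℚ 8) :* SL :+ (M :+ Q) :+ Q
          :+ (con (ℕtoℚ 8) :* (con (ℕtoℚ 7) :* (M :+ Q)) :+ con (ℕtoℚ 5) :* M)))
        := con (ℕtoℚ 62) :* (M :+ Q) :+ (L :+ (X :+ (con (ℕtoℚ 8) :* SL :+ con 0ℚ)))) refl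
      (sumℚ atMediumDominating) (sumℚ (λ p → when (unique? p) (G (η p)))) totalSlack M Q)
    where
    G : K → ℚ
    G v = ℕtoℚ 4 * q v + ℕtoℚ 8 * linkSlack v + opt v + r v
    G-nonneg : ∀ v → 0ℚ ≤ G v
    G-nonneg v = +-nonneg (+-nonneg (+-nonneg (*-nonneg (ℕtoℚ-nonneg 4) (q-nonneg v))
      (*-nonneg (ℕtoℚ-nonneg 8) (linkSlack-nonneg v))) (opt-nonneg v)) (r-nonneg v)
    sum-G : sumℚ G ≡ ℕtoℚ 4 * Q + ℕtoℚ 8 * totalSlack + (M + Q) + Q
    sum-G = trans (sum-+ (λ v → ℕtoℚ 4 * q v + ℕtoℚ 8 * linkSlack v + opt v) r) (cong₂ _+_
      (trans (sum-+ (λ v → ℕtoℚ 4 * q v + ℕtoℚ 8 * linkSlack v) opt) (cong₂ _+_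
        (trans (sum-+ (λ v → ℕtoℚ 4 * q v) (λ v → ℕtoℚ 8 * linkSlack v)) (cong₂ _+_
          (trans (sum-*ˡ (ℕtoℚ 4) q) (cong (ℕtoℚ 4 *_) sum-q))
          (sum-*ˡ (ℕtoℚ 8) linkSlack)))
        (trans (sum-+ m r) (cong (M +_) sum-r))))
      sum-r)
    G-eq : ∀ v → Unique v → ℕtoℚ 4 * q v + ℕtoℚ 8 * slack v + opt v + r v ≡ G v
    G-eq v u = cong (λ x → ℕtoℚ 4 * q v + ℕtoℚ 8 * x + opt v + r v) (sym (when-yes (unique? v) u))
    dominating : ∀ p {κ} → captured (η p) ≤ ℕtoℚ 2 * w (η p) → Kind (η p) κ →
                 on isDominating κ (U (η p)) ≤ G (η p)
    dominating p le (is-shared _) = G-nonneg (η p)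
    dominating p le (is-light _ _) = G-nonneg (η p)
    dominating p le (is-medium u ge _) = ℚP.≤-trans (dominating-node (η p) u ge le) (ℚP.≤-reflexive (G-eq (η p) u))
    dominating p le (is-heavy u ge _)  = ℚP.≤-trans (dominating-node (η p) u ge le) (ℚP.≤-reflexive (G-eq (η p) u))
    rhs-nonneg : ∀ p → 0ℚ ≤ when (unique? p) (G (η p))
    rhs-nonneg p = when-nonneg (unique? p) (λ _ → G-nonneg (η p))
    pointwise : ∀ p {κ κ′} → Kind p κ → Kind (η p) κ′ →
                on isMedium κ (on isDominating κ′ (U (η p))) ≤ when (unique? p) (G (η p))
    pointwise p (is-shared _)      _  = rhs-nonneg p
    pointwise p (is-light _ _)     _  = rhs-nonneg p
    pointwise p (is-heavy _ _ _)   _  = rhs-nonneg p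
    pointwise p (is-medium u _ le) κ′ =
      ℚP.≤-trans (dominating p le κ′) (ℚP.≤-reflexive (sym (when-yes (unique? p) u)))

  -- `U-step` replaces `U (η p)` by `U p`, and `sum-split` then reindexes by the link entering the
  -- node. The class condition thereby passes from a link to its successor.
  on-sum-bound : ∀ χ → sumℚ (λ p → on χ (link p) (U (η p))) ≤
    nonsingle + sumℚ (λ p → when (unique? p) (on χ (link (η p)) (U (η p)))) + (M + M)
  on-sum-bound χ = ≤-by
    (subst (sumℚ (λ p → on χ (link p) (U (η p))) ≤_)
        (trans (sum-+ (λ p → on χ (link p) (U p)) (λ p → m p + m p))
               (cong (sumℚ (λ p → on χ (link p) (U p)) +_) (sum-+ m m)))
        (sum-mono (λ p → step p (link p)))
      ⊕ ℚP.≤-reflexive (sum-split (λ v → on χ (link v) (U v)))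
      ⊕ sum-mono (λ v → when-mono (¬? (single? v)) (λ _ → on-≤ χ (link v) (U-nonneg v))))
    (solve 6 (λ L R X Y NS M → L :+ (R :+ (M :+ M) :+ (X :+ Y :+ NS))
        := NS :+ Y :+ (M :+ M) :+ (L :+ (R :+ X))) refl
      (sumℚ (λ p → on χ (link p) (U (η p)))) (sumℚ (λ p → on χ (link p) (U p)))
      (sumℚ (λ v → when (¬? (single? v)) (on χ (link v) (U v))))
      (sumℚ (λ p → when (unique? p) (on χ (link (η p)) (U (η p))))) nonsingle M)
    where
    step : ∀ p κ → on χ κ (U (η p)) ≤ on χ κ (U p) + (m p + m p)
    step p κ with χ κ
    ... | true  = U-step p
    ... | false = ℚP.≤-trans (+-nonneg (m-nonneg p) (m-nonneg p)) (ℚP.≤-reflexive (sym (ℚP.+-identityˡ _)))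

  -- Heavy links followed by heavy ones occur on both sides of `on-sum-bound` and cancel. Only the
  -- last links of heavy runs stay on the left; the right keeps runs entered from a light or medium
  -- link, and `nonsingle`.
  heavyEnd-bound : sumℚ atHeavyEnd ≤ ℕtoℚ 126 * C
  heavyEnd-bound = ≤-by
    (on-sum-bound isHeavy
      ⊕ subst (sumℚ (λ p → when (unique? p) (on isHeavy (link (η p)) (U (η p)))) ≤_)
          (trans (sum-+ atLight (λ p → atMediumDominating p + inner p))
                 (cong (sumℚ atLight +_) (sum-+ atMediumDominating inner)))
          (sum-mono (λ p → pointwise p (proj₂ (kind p)) (link (η p))))
      ⊕ ℚP.≤-reflexive (trans (sym (sum-+ atHeavyEnd inner)) (sum-cong (λ p → split (link p) (link (η p)) (U (η p)))))
      ⊕ nonsingle-bound ⊕ light-bound ⊕ mediumDominating-bound ⊕ Q-nonneg ⊕ Q-nonneg)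
    (solve 9 (λ E H NS Y L MD I M Q →
        E :+ (NS :+ Y :+ (M :+ M) :+ (L :+ (MD :+ I) :+ (H :+ (con (ℕtoℚ 4) :* (M :+ Q)
          :+ (con (ℕtoℚ 58) :* (M :+ Q) :+ (con (ℕtoℚ 62) :* (M :+ Q) :+ (Q :+ Q)))))))
        := con (ℕtoℚ 126) :* (M :+ Q) :+ (H :+ (Y :+ (E :+ I :+ (NS :+ (L :+ (MD :+ (con 0ℚ :+ con 0ℚ)))))))) refl
      (sumℚ atHeavyEnd) (sumℚ (λ p → on isHeavy (link p) (U (η p)))) nonsingle
      (sumℚ (λ p → when (unique? p) (on isHeavy (link (η p)) (U (η p)))))
      (sumℚ atLight) (sumℚ atMediumDominating) (sumℚ inner) M Q)
    where
    inner : K → ℚ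
    inner p = on isHeavy (link p) (on isHeavy (link (η p)) (U (η p)))
    split : ∀ κ κ′ x → on isHeavy κ (on isNotHeavy κ′ x) + on isHeavy κ (on isHeavy κ′ x) ≡ on isHeavy κ x
    split shared κ′     x = refl
    split light  κ′     x = refl
    split medium κ′     x = refl
    split heavy  shared x = ℚP.+-identityʳ x
    split heavy  light  x = ℚP.+-identityʳ x
    split heavy  medium x = ℚP.+-identityʳ x
    split heavy  heavy  x = ℚP.+-identityˡ x
    pointwise : ∀ p {κ} → Kind p κ → ∀ κ′ → when (unique? p) (on isHeavy κ′ (U (η p))) ≤
      on isLight κ (U (η p)) + (on isMedium κ (on isDominating κ′ (U (η p))) + on isHeavy κ (on isHeavy κ′ (U (η p))))
    pointwise p (is-shared ¬u) κ′ = ℚP.≤-reflexive (when-no (unique? p) ¬u)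
    pointwise p (is-light u _) κ′ = ℚP.≤-trans (ℚP.≤-reflexive (when-yes (unique? p) u))
      (ℚP.≤-trans (on-≤ isHeavy κ′ (U-nonneg (η p))) (ℚP.≤-reflexive (sym (ℚP.+-identityʳ _))))
    pointwise p (is-medium u _ _) κ′ = ℚP.≤-trans (ℚP.≤-reflexive (when-yes (unique? p) u))
      (ℚP.≤-trans (heavy≤dominating κ′) (ℚP.≤-reflexive (sym (trans (ℚP.+-identityˡ _) (ℚP.+-identityʳ _)))))
      where
      heavy≤dominating : ∀ κ′ → on isHeavy κ′ (U (η p)) ≤ on isDominating κ′ (U (η p))
      heavy≤dominating shared = ℚP.≤-refl
      heavy≤dominating light  = ℚP.≤-refl
      heavy≤dominating medium = U-nonneg (η p)
      heavy≤dominating heavy  = ℚP.≤-refl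
    pointwise p (is-heavy u _ _) κ′ = ℚP.≤-trans (ℚP.≤-reflexive (when-yes (unique? p) u))
      (ℚP.≤-reflexive (sym (trans (ℚP.+-identityˡ _) (ℚP.+-identityˡ _))))

  -- The link before a medium one is light, medium or heavy; the last two cases fall under
  -- `atMediumDominating` and `atHeavyEnd`.
  medium-bound : sumℚ atMedium ≤ ℕtoℚ 252 * C
  medium-bound = ≤-by
    (on-sum-bound isMedium
      ⊕ subst (sumℚ (λ p → when (unique? p) (on isMedium (link (η p)) (U (η p)))) ≤_)
          (trans (sum-+ atLight (λ p → atMediumDominating p + atHeavyEnd p))
                 (cong (sumℚ atLight +_) (sum-+ atMediumDominating atHeavyEnd)))
          (sum-mono (λ p → pointwise p (proj₂ (kind p)) (link (η p))))
      ⊕ nonsingle-bound ⊕ light-bound ⊕ mediumDominating-bound ⊕ heavyEnd-bound ⊕ Q-nonneg ⊕ Q-nonneg)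
    (solve 8 (λ H NS Y L MD E M Q →
        H :+ (NS :+ Y :+ (M :+ M) :+ (L :+ (MD :+ E) :+ (con (ℕtoℚ 4) :* (M :+ Q)
          :+ (con (ℕtoℚ 58) :* (M :+ Q) :+ (con (ℕtoℚ 62) :* (M :+ Q) :+ (con (ℕtoℚ 126) :* (M :+ Q) :+ (Q :+ Q)))))))
        := con (ℕtoℚ 252) :* (M :+ Q) :+ (H :+ (Y :+ (NS :+ (L :+ (MD :+ (E :+ (con 0ℚ :+ con 0ℚ)))))))) refl
      (sumℚ atMedium) nonsingle
      (sumℚ (λ p → when (unique? p) (on isMedium (link (η p)) (U (η p)))))
      (sumℚ atLight) (sumℚ atMediumDominating) (sumℚ atHeavyEnd) M Q)
    where
    pointwise : ∀ p {κ} → Kind p κ → ∀ κ′ → when (unique? p) (on isMedium κ′ (U (η p))) ≤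
      on isLight κ (U (η p)) + (on isMedium κ (on isDominating κ′ (U (η p))) + on isHeavy κ (on isNotHeavy κ′ (U (η p))))
    pointwise p (is-shared ¬u) κ′ = ℚP.≤-reflexive (when-no (unique? p) ¬u)
    pointwise p (is-light u _) κ′ = ℚP.≤-trans (ℚP.≤-reflexive (when-yes (unique? p) u))
      (ℚP.≤-trans (on-≤ isMedium κ′ (U-nonneg (η p))) (ℚP.≤-reflexive (sym (ℚP.+-identityʳ _))))
    pointwise p (is-medium u _ _) κ′ = ℚP.≤-trans (ℚP.≤-reflexive (when-yes (unique? p) u))
      (ℚP.≤-trans (medium≤dominating κ′) (ℚP.≤-reflexive (sym (trans (ℚP.+-identityˡ _) (ℚP.+-identityʳ _)))))
      where
      medium≤dominating : ∀ κ′ → on isMedium κ′ (U (η p)) ≤ on isDominating κ′ (U (η p))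
      medium≤dominating shared = ℚP.≤-refl
      medium≤dominating light  = ℚP.≤-refl
      medium≤dominating medium = ℚP.≤-refl
      medium≤dominating heavy  = U-nonneg (η p)
    pointwise p (is-heavy u _ _) κ′ = ℚP.≤-trans (ℚP.≤-reflexive (when-yes (unique? p) u))
      (ℚP.≤-trans (medium≤notHeavy κ′) (ℚP.≤-reflexive (sym (trans (ℚP.+-identityˡ _) (ℚP.+-identityˡ _)))))
      where
      medium≤notHeavy : ∀ κ′ → on isMedium κ′ (U (η p)) ≤ on isNotHeavy κ′ (U (η p))
      medium≤notHeavy shared = U-nonneg (η p)
      medium≤notHeavy light  = U-nonneg (η p)
      medium≤notHeavy medium = ℚP.≤-refl
      medium≤notHeavy heavy  = ℚP.≤-refl

  -- `h` is at most `U` except at nodes where a heavy link enters and another leaves; there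
  -- `heavy-node` bounds it directly. The constant is 4 + 58 + 252 + 126 from the `U` sums and 7 +
  -- 14 from `heavy-node`.
  h-bound : sumℚ h ≤ ℕtoℚ 461 * C
  h-bound = ≤-by
    (ℚP.≤-reflexive (sum-split h)
      ⊕ sum-mono (λ v → when-mono (¬? (single? v)) (λ _ → h≤U v))
      ⊕ subst (sumℚ (λ p → when (unique? p) (h (η p))) ≤_)
          (trans (sum-+ atLight (λ p → atMedium p + (atHeavyEnd p + pulled p)))
            (cong (sumℚ atLight +_) (trans (sum-+ atMedium (λ p → atHeavyEnd p + pulled p))
              (cong (sumℚ atMedium +_) (sum-+ atHeavyEnd pulled)))))
          (sum-mono (λ p → pointwise p (proj₂ (kind p)) (proj₂ (kind (η p)))))
      ⊕ sum-pull G G-nonneg ⊕ ℚP.≤-reflexive sum-G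
      ⊕ *-monoʳ (ℕtoℚ-nonneg 8) (ℚP.≤-trans (sum-pull q q-nonneg) (ℚP.≤-reflexive sum-q))
      ⊕ nonsingle-bound ⊕ light-bound ⊕ medium-bound ⊕ heavyEnd-bound ⊕ totalSlack-bound
      ⊕ *-nonneg (ℕtoℚ-nonneg 14) M-nonneg)
    (solve 13 (λ h X Y NS L Md E P G SL qη M Q →
        h :+ (X :+ Y :+ (NS :+ (L :+ (Md :+ (E :+ P)) :+ (G :+ (SL :+ con (ℕtoℚ 8) :* qη :+ con (ℕtoℚ 6) :* Q
          :+ (con (ℕtoℚ 8) :* Q :+ (con (ℕtoℚ 4) :* (M :+ Q) :+ (con (ℕtoℚ 58) :* (M :+ Q) :+ (con (ℕtoℚ 252) :* (M :+ Q)
          :+ (con (ℕtoℚ 126) :* (M :+ Q) :+ (con (ℕtoℚ 7) :* (M :+ Q) :+ con (ℕtoℚ 14) :* M)))))))))))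
        := con (ℕtoℚ 461) :* (M :+ Q) :+ (h :+ (X :+ (Y :+ (P :+ (G :+ (con (ℕtoℚ 8) :* qη
          :+ (NS :+ (L :+ (Md :+ (E :+ (SL :+ con 0ℚ)))))))))))) refl
      (sumℚ h) (sumℚ (λ v → when (¬? (single? v)) (h v))) (sumℚ (λ p → when (unique? p) (h (η p))))
      nonsingle (sumℚ atLight) (sumℚ atMedium) (sumℚ atHeavyEnd) (sumℚ pulled) (sumℚ G)
      totalSlack (sumℚ (λ p → when (unique? p) (q (η p)))) M Q)
    where
    qη : K → ℚ
    qη p = when (unique? p) (q (η p))
    qη-nonneg : ∀ p → 0ℚ ≤ qη p
    qη-nonneg p = when-nonneg (unique? p) (λ _ → q-nonneg (η p))
    -- The bound of `heavy-node`, with slack and `q (η v)` restricted to unique links so that they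
    -- sum to `totalSlack` and at most `Q`.
    G : K → ℚ
    G v = linkSlack v + ℕtoℚ 8 * qη v + ℕtoℚ 6 * r v
    G-nonneg : ∀ v → 0ℚ ≤ G v
    G-nonneg v = +-nonneg (+-nonneg (linkSlack-nonneg v) (*-nonneg (ℕtoℚ-nonneg 8) (qη-nonneg v)))
                          (*-nonneg (ℕtoℚ-nonneg 6) (r-nonneg v))
    sum-G : sumℚ G ≡ totalSlack + ℕtoℚ 8 * sumℚ qη + ℕtoℚ 6 * Q
    sum-G = trans (sum-+ (λ v → linkSlack v + ℕtoℚ 8 * qη v) (λ v → ℕtoℚ 6 * r v)) (cong₂ _+_
      (trans (sum-+ linkSlack (λ v → ℕtoℚ 8 * qη v)) (cong (totalSlack +_) (sum-*ˡ (ℕtoℚ 8) qη)))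
      (trans (sum-*ˡ (ℕtoℚ 6) r) (cong (ℕtoℚ 6 *_) sum-r)))
    pulled : K → ℚ
    pulled p = when (unique? p) (G (η p))
    pulled-nonneg : ∀ p → 0ℚ ≤ pulled p
    pulled-nonneg p = when-nonneg (unique? p) (λ _ → G-nonneg (η p))
    h≤U+pulled : ∀ p → h (η p) ≤ U (η p) + pulled p
    h≤U+pulled p = ℚP.≤-trans (ℚP.≤-reflexive (sym (ℚP.+-identityʳ _))) (h≤U (η p) ⊕ pulled-nonneg p)
    heavyTwice : ∀ p → Unique p → Kind (η p) heavy → h (η p) ≤ pulled p
    heavyTwice p u κ@(is-heavy u′ _ _) = ℚP.≤-trans (heavy-node (η p) κ) (ℚP.≤-reflexive
      (trans (trans (sym (ℚP.+-assoc (slack (η p)) (ℕtoℚ 8 * q (η (η p))) (ℕtoℚ 6 * r (η p))))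
                    (cong₂ (λ x y → x + ℕtoℚ 8 * y + ℕtoℚ 6 * r (η p))
                      (sym (when-yes (unique? (η p)) u′)) (sym (when-yes (unique? (η p)) u′))))
             (sym (when-yes (unique? p) u))))
    target : ∀ p → Link → Link → ℚ
    target p κ κ′ = on isLight κ (U (η p)) + (on isMedium κ (U (η p))
      + (on isHeavy κ (on isNotHeavy κ′ (U (η p))) + pulled p))
    heavyCase : ∀ p {κ′} → Unique p → Kind (η p) κ′ → h (η p) ≤ on isNotHeavy κ′ (U (η p)) + pulled p
    heavyCase p u (is-shared _)     = h≤U+pulled p
    heavyCase p u (is-light _ _)    = h≤U+pulled p
    heavyCase p u (is-medium _ _ _) = h≤U+pulled p
    heavyCase p u κ@(is-heavy _ _ _) = ℚP.≤-trans (heavyTwice p u κ) (ℚP.≤-reflexive (sym (ℚP.+-identityˡ (pulled p))))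
    pointwise : ∀ p {κ κ′} → Kind p κ → Kind (η p) κ′ → when (unique? p) (h (η p)) ≤ target p κ κ′
    pointwise p {κ} {κ′} (is-shared ¬u) _ = ℚP.≤-trans (ℚP.≤-reflexive (when-no (unique? p) ¬u))
      (+-nonneg ℚP.≤-refl (+-nonneg ℚP.≤-refl (+-nonneg ℚP.≤-refl (pulled-nonneg p))))
    pointwise p (is-light u _) _ = ℚP.≤-trans (ℚP.≤-reflexive (when-yes (unique? p) u))
      (ℚP.≤-trans (h≤U+pulled p) (ℚP.≤-reflexive (cong (U (η p) +_) (sym (trans (ℚP.+-identityˡ _) (ℚP.+-identityˡ _))))))
    pointwise p (is-medium u _ _) _ = ℚP.≤-trans (ℚP.≤-reflexive (when-yes (unique? p) u))
      (ℚP.≤-trans (h≤U+pulled p) (ℚP.≤-reflexive (sym (trans (ℚP.+-identityˡ _) (cong (U (η p) +_) (ℚP.+-identityˡ _))))))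
    pointwise p (is-heavy u _ _) κ′ = ℚP.≤-trans (ℚP.≤-reflexive (when-yes (unique? p) u))
      (ℚP.≤-trans (heavyCase p u κ′) (ℚP.≤-reflexive (sym (trans (ℚP.+-identityˡ _) (ℚP.+-identityˡ _)))))

  cost-bound : solutionCost I s ≤ ℕtoℚ 462 * solutionCost I o
  cost-bound = ≤-by (ℚP.≤-reflexive solutionCost-s ⊕ h-bound)
    (solve 3 (λ S H C → S :+ (H :+ C :+ con (ℕtoℚ 461) :* C) := con (ℕtoℚ 462) :* C :+ (S :+ H)) refl
      (solutionCost I s) (sumℚ h) C)

-- Conclusion with the constant 462.

theorem6p6 : Σ ℚ λ β → ∀ (I : Instance) (S : Fin (k I) → Fin (Instance.n I)) → IsLocationSet I S → IsSwapLocalOpt I S → ∀ (x : ℚ) → IsSetCost I S x → ∀ (s* : Solution I) → IsOptimal I s* → x ≤ β * solutionCost I s*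
theorem6p6 = ℕtoℚ 462 , λ I S S-inj locOpt x isCost s* _ → bound I S S-inj locOpt x isCost s*
  where
  bound : ∀ I S → IsLocationSet I S → IsSwapLocalOpt I S → ∀ x → IsSetCost I S x → ∀ s* →
          x ≤ ℕtoℚ 462 * solutionCost I s*
  bound I S S-inj locOpt x isCost@((π , x≡) , _) s* =
    ℚP.≤-trans (ℚP.≤-reflexive x≡)
      -- `S` is reindexed by a matching `π` attaining its cost, so that facility `i` ends at the
      -- location with index `i`; closing `t` then means closing index `π ⟨$⟩ʳ t` of `S`.
      (Exchange.cost-bound I (λ i → S (π ⟨$⟩ʳ i)) (λ eq → permutation-injective π (S-inj eq)) s* localOpt
        (λ j → ℕtoℚ (Instance.demand I j)) (λ _ → refl))
    where
    open LocationSets I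
    localOpt : ∀ s′ t → (s′ CoversExcept (λ i → S (π ⟨$⟩ʳ i))) t →
               solutionCost I (λ i → S (π ⟨$⟩ʳ i)) ≤ solutionCost I s′
    localOpt s′ t cov = ℚP.≤-trans (ℚP.≤-reflexive (sym x≡))
      (localOpt-covers S S-inj locOpt x isCost s′ (π ⟨$⟩ʳ t) λ u u≢ →
        let l , eq = cov (π ⟨$⟩ˡ u) (λ e → u≢ (trans (sym (inverseʳ π)) (cong (π ⟨$⟩ʳ_) e)))
        in  l , trans eq (cong S (inverseʳ π)))
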